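{- Let $k\geqslant 4$ be an integer. For $0\leqslant i\leqslant 8$ let $\Gamma_i^{(4),k}$ denote the number of $8\times k$ matrices over $\mathbb{F}_2$ of the form \[ \begin{pmatrix} \alpha_1^{(1)} & \alpha_2^{(1)} & \cdots & \alpha_k^{(1)}\\ \alpha_2^{(1)} & \alpha_3^{(1)} & \cdots & \alpha_{k+1}^{(1)}\\ \alpha_1^{(2)} & \alpha_2^{(2)} & \cdots & \alpha_k^{(2)}\\ \alpha_2^{(2)} & \alpha_3^{(2)} & \cdots & \alpha_{k+1}^{(2)}\\ \alpha_1^{(3)} & \alpha_2^{(3)} & \cdots & \alpha_k^{(3)}\\ \alpha_2^{(3)} & \alpha_3^{(3)} & \cdots & \alpha_{k+1}^{(3)}\\ \alpha_1^{(4)} & \alpha_2^{(4)} & \cdots & \alpha_k^{(4)}\\ \alpha_2^{(4)} & \alpha_3^{(4)} & \cdots & \alpha_{k+1}^{(4)} \end{pmatrix} \] (with $\alpha_j^{(m)}\in\mathbb{F}_2$) having rank $i$ over $\mathbb{F}_2$. Then \[ \Gamma_i^{(4),k}=\begin{cases} 1 & i=0,\\ 45 & i=1,\\ 30\cdot 2^{k}+1410 & i=2,\\ 1470\cdot 2^{k}+31920 & i=3,\\ 140\cdot 2^{2k}+42420\cdot 2^{k}+276640 & i=4,\\ 6300\cdot 2^{2k}+630000\cdot 2^{k}-11692800 & i=5,\\ 120\cdot 2^{3k}+123480\cdot 2^{2k}-6142080\cdot 2^{k}+66170880 & i=6,\\ 3720\cdot 2^{3k}-416640\cdot 2^{2k}+13332480\cdot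 2^{k}-121896960 & i=7,\\ 16\cdot 2^{4k}-3840\cdot 2^{3k}+286720\cdot 2^{2k}-7864320\cdot 2^{k}+2^{26} & i=8. \end{cases} \]
   Context: The matrices counted are "quadruple persymmetric" matrices: they consist of four $2\times k$ blocks stacked vertically, the $m$-th block ($m=1,\dots,4$) being determined by a vector $(\alpha_1^{(m)},\dots,\alpha_{k+1}^{(m)})\in\mathbb{F}_2^{k+1}$, with first row $(\alpha_1^{(m)},\dots,\alpha_k^{(m)})$ and second row $(\alpha_2^{(m)},\dots,\alpha_{k+1}^{(m)})$. The count ranges over all $2^{4(k+1)}$ choices of the entries $\alpha_j^{(m)}$, $1\le j\le k+1$, $1\le m\le 4$. -}

module Defs where

open import Data.Bool using (Bool; true; false; _xor_; _∧_; not; if_then_else_)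
open import Data.Nat using (ℕ; zero; suc; _⊔_; _≡ᵇ_)
open import Data.List using (List; []; _∷_; _++_; map; concatMap; length; foldr; filterᵇ)
open import Data.Vec using (Vec; []; _∷_; zipWith; replicate; init; tail; toList)

-- Rows of a matrix over F₂ (F₂ represented by Bool, addition = xor).
Row : ℕ → Set
Row k = Vec Bool k

_⊕_ : ∀ {k} → Row k → Row k → Row k
_⊕_ = zipWith _xor_

zeroRow : ∀ k → Row k
zeroRow k = replicate k false

isZero : ∀ {k} → Row k → Bool
isZero []          = true
isZero (b ∷ r) = not b ∧ isZero r

sublists : ∀ {A : Set} → List A → List (List A)
sublists []       = [] ∷ []
sublists (x ∷ xs) = let s = sublists xs in s ++ map (x ∷_) s

sumRows : ∀ {k} → List (Row k) → Row k
sumRows {k} = foldr _⊕_ (zeroRow k)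

allB : ∀ {A : Set} → (A → Bool) → List A → Bool
allB p = foldr (λ x b → p x ∧ b) true

nonEmpty : ∀ {A : Set} → List A → Bool
nonEmpty []      = false
nonEmpty (_ ∷ _) = true

-- A family of rows is linearly independent over F₂ iff no nonempty
-- sub-family sums to zero (over F₂ every linear combination is a subset sum).
independent : ∀ {k} → List (Row k) → Bool
independent rs = allB (λ s → not (nonEmpty s) Data.Bool.∨ not (isZero (sumRows s))) (sublists rs)

maximum : List ℕ → ℕ
maximum = foldr _⊔_ 0

rank : ∀ {k} → List (Row k) → ℕ
rank rs = maximum (map length (filterᵇ independent (sublists rs)))

allVecs : ∀ {A : Set} → List A → (n : ℕ) → List (Vec A n)
allVecs xs zero    = [] ∷ []
allVecs xs (suc n) = concatMap (λ x → map (x ∷_) (allVecs xs n)) xs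

allBits : (n : ℕ) → List (Vec Bool n)
allBits = allVecs (false ∷ true ∷ [])

block : ∀ {k} → Vec Bool (suc k) → List (Row k)
block α = init α ∷ tail α ∷ []

quadMatrix : ∀ {k} → Vec (Vec Bool (suc k)) 4 → List (Row k)
quadMatrix (a₁ ∷ a₂ ∷ a₃ ∷ a₄ ∷ []) = block a₁ ++ block a₂ ++ block a₃ ++ block a₄

Γ : ℕ → ℕ → ℕ
Γ i k = length (filterᵇ (λ αs → rank (quadMatrix {k} αs) ≡ᵇ i) (allVecs (allBits (suc k)) 4))

{-# OPTIONS --safe #-}
module Submission where

-- The columns of the matrix are the pairs (aⱼ , aⱼ₊₁) of consecutive terms of a sequence
-- a₁, …, aₖ₊₁ in F₂⁴.  To a sequence attach the dimension r of the span W of these columns, the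
-- dimension d of the span U of a₂, …, aₖ₊₁, and whether a₁ ∈ U.  The second projection maps W onto
-- U with kernel of size 2^(r − d), and W ⊆ (F₂ a₁ + U) × U, so if a₁ ∈ U exactly 2^(r − d) of the
-- vectors a₀ satisfy (a₀ , a₁) ∈ W, all of them in U; if a₁ ∉ U there are none.  Hence the number
-- of ways to prepend a term and reach a given triple depends only on the current triple, which
-- gives a linear recurrence in k for the number of sequences with a given triple.  Its solutions
-- are polynomials in 2ᵏ for k ≥ 4.

open import Defs
open import Data.Nat using (ℕ; _≥_)
open import Data.Product using (_×_)
open import Relation.Binary.PropositionalEquality using (_≡_)

open import Algebra.Bundles using (CommutativeRing)
import Algebra.Properties.CommutativeSemigroup as CommutativeSemigroupProperties
open import Data.Bool using (Bool; true; false; T; not; _∧_; _∨_; _xor_; if_then_else_)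
open import Data.Bool.Properties
  using (T-∨; T-∧; T?; ∨-idem; ∧-assoc; ∧-comm; ∧-identityʳ; ∧-zeroʳ; ∧-distribʳ-xor; not-involutive;
         xor-assoc; xor-comm; xor-identityˡ; xor-identityʳ; xor-same; xor-∧-commutativeRing)
open import Data.Empty using (⊥-elim)
open import Data.List using (List; []; _∷_; _++_; map; concatMap; length; filterᵇ)
open import Data.List.Membership.Propositional using (_∈_)
open import Data.List.Membership.Propositional.Properties
  using (∈-++⁺ˡ; ∈-++⁺ʳ; ∈-++⁻; ∈-map⁺; ∈-map⁻; ∈-filter⁺; ∈-filter⁻)
open import Data.List.Relation.Unary.All as All using (All; []; _∷_)
open import Data.List.Relation.Unary.Any using (here; there)
open import Data.Nat using (zero; suc; _∸_; _≤_; _<_; z≤n; s≤s; NonZero; _≡ᵇ_)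
open import Data.Product using (∃; _,_; proj₁; proj₂)
open import Data.Sum using (_⊎_; inj₁; inj₂)
open import Data.Unit using (tt)
open import Data.Vec as Vec using (Vec; []; _∷_; zipWith; replicate; toList; init; tail)
open import Data.Vec.Properties using (zipWith-assoc; zipWith-comm; zipWith-identityˡ; zipWith-identityʳ; ≡-dec)
open import Function using (_∘_)
open import Function.Bundles using (Equivalence)
open import Relation.Nullary using (¬_; Dec; yes; no)
open import Relation.Nullary.Decidable using (from-yes; True; toWitness; _×-dec_)
open import Relation.Binary.PropositionalEquality
  using (refl; sym; trans; cong; cong₂; subst; subst₂; module ≡-Reasoning)

-- The rank in the statement is the largest number of independent rows, while the recurrence follows
-- columns, so equality of row and column rank has to be proved for this very definition. It is
-- obtained by counting: spans, kernels and orthogonal complements over F₂ have sizes that are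
-- powers of 2, and dimensions are compared through these sizes, without exchanging bases. That the
-- solutions are polynomials in 2ᵏ, with no factors of k, comes from the shape of the recurrence.
-- Only a state with a₁ ∈ U can be kept by prepending a term, and it is kept in 2^(r - d) ways.
-- Leaving such a state raises r - d by 1, while a step from a state with a₁ ∉ U leaves r - d alone.
-- So a chain of states meets each of the loop weights 1, 2, 4, 8, 16 at most once, and these are
-- the growth rates. Linearly independent sequences a₁, ..., aₖ₊₁ give states with a₁ ∉ U and r = d,
-- outside this pattern; they exist only for k ≤ 3, whence the bound k ≥ 4.

T-ext : ∀ {a b} → (T a → T b) → (T b → T a) → a ≡ b
T-ext {false} {false} f g = refl
T-ext {false} {true}  f g = ⊥-elim (g tt)
T-ext {true}  {false} f g = ⊥-elim (f tt)
T-ext {true}  {true}  f g = refl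

∨⁻ : ∀ {a b} → T (a ∨ b) → T a ⊎ T b
∨⁻ = Equivalence.to T-∨

∨⁺ : ∀ {a b} → T a ⊎ T b → T (a ∨ b)
∨⁺ = Equivalence.from T-∨

∧⁻ : ∀ {a b} → T (a ∧ b) → T a × T b
∧⁻ = Equivalence.to T-∧

∧⁺ : ∀ {a b} → T a × T b → T (a ∧ b)
∧⁺ = Equivalence.from T-∧

module Counting where

  open import Data.Nat using (_+_; _*_; _^_)
  open import Data.Nat.Properties

  -- Finite sums over lists and over the enumeration of F₂ⁿ

  ∑ : ∀ {A : Set} → List A → (A → ℕ) → ℕ
  ∑ []       f = 0
  ∑ (x ∷ xs) f = f x + ∑ xs f

  ∑-cong : ∀ {A : Set} (xs : List A) {f g : A → ℕ} → (∀ x → f x ≡ g x) → ∑ xs f ≡ ∑ xs g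
  ∑-cong []       eq = refl
  ∑-cong (x ∷ xs) eq = cong₂ _+_ (eq x) (∑-cong xs eq)

  ∑-mono-≤ : ∀ {A : Set} (xs : List A) {f g : A → ℕ} → (∀ x → f x ≤ g x) → ∑ xs f ≤ ∑ xs g
  ∑-mono-≤ []       le = z≤n
  ∑-mono-≤ (x ∷ xs) le = +-mono-≤ (le x) (∑-mono-≤ xs le)

  ∑-zero : ∀ {A : Set} (xs : List A) → ∑ xs (λ _ → 0) ≡ 0
  ∑-zero []       = refl
  ∑-zero (x ∷ xs) = ∑-zero xs

  +-interchange : ∀ a b c d → (a + b) + (c + d) ≡ (a + c) + (b + d)
  +-interchange = CommutativeSemigroupProperties.interchange +-commutativeSemigroup

  ∑-+ : ∀ {A : Set} (xs : List A) (f g : A → ℕ) → ∑ xs (λ x → f x + g x) ≡ ∑ xs f + ∑ xs g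
  ∑-+ []       f g = refl
  ∑-+ (x ∷ xs) f g =
    trans (cong (f x + g x +_) (∑-+ xs f g)) (+-interchange (f x) (g x) (∑ xs f) (∑ xs g))

  ∑-*ˡ : ∀ {A : Set} (xs : List A) c (f : A → ℕ) → ∑ xs (λ x → c * f x) ≡ c * ∑ xs f
  ∑-*ˡ []       c f = sym (*-zeroʳ c)
  ∑-*ˡ (x ∷ xs) c f =
    trans (cong (c * f x +_) (∑-*ˡ xs c f)) (sym (*-distribˡ-+ c (f x) (∑ xs f)))

  ∑-*ʳ : ∀ {A : Set} (xs : List A) c (f : A → ℕ) → ∑ xs (λ x → f x * c) ≡ ∑ xs f * c
  ∑-*ʳ xs c f =
    trans (∑-cong xs λ x → *-comm (f x) c) (trans (∑-*ˡ xs c f) (*-comm c (∑ xs f)))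

  ∑-swap : ∀ {A B : Set} (xs : List A) (ys : List B) (f : A → B → ℕ) →
           ∑ xs (λ x → ∑ ys (f x)) ≡ ∑ ys (λ y → ∑ xs (λ x → f x y))
  ∑-swap []       ys f = sym (∑-zero ys)
  ∑-swap (x ∷ xs) ys f =
    trans (cong (∑ ys (f x) +_) (∑-swap xs ys f)) (sym (∑-+ ys (f x) _))

  ∑-++ : ∀ {A : Set} (xs ys : List A) (f : A → ℕ) → ∑ (xs ++ ys) f ≡ ∑ xs f + ∑ ys f
  ∑-++ []       ys f = refl
  ∑-++ (x ∷ xs) ys f = trans (cong (f x +_) (∑-++ xs ys f)) (sym (+-assoc (f x) _ _))

  ∑-map : ∀ {A B : Set} (h : A → B) (xs : List A) (f : B → ℕ) → ∑ (map h xs) f ≡ ∑ xs (f ∘ h)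
  ∑-map h []       f = refl
  ∑-map h (x ∷ xs) f = cong (f (h x) +_) (∑-map h xs f)

  ∑-concatMap : ∀ {A B : Set} (h : A → List B) (xs : List A) (f : B → ℕ) →
                ∑ (concatMap h xs) f ≡ ∑ xs (λ x → ∑ (h x) f)
  ∑-concatMap h []       f = refl
  ∑-concatMap h (x ∷ xs) f =
    trans (∑-++ (h x) (concatMap h xs) f) (cong (∑ (h x) f +_) (∑-concatMap h xs f))

  ∑-allVecs : ∀ {A : Set} (xs : List A) n (f : Vec A (suc n) → ℕ) →
              ∑ (allVecs xs (suc n)) f ≡ ∑ xs (λ x → ∑ (allVecs xs n) (λ v → f (x ∷ v)))
  ∑-allVecs xs n f =
    trans (∑-concatMap (λ x → map (x ∷_) (allVecs xs n)) xs f)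
          (∑-cong xs λ x → ∑-map (x ∷_) (allVecs xs n) f)

  ∑-allBits : ∀ n (f : Vec Bool (suc n) → ℕ) →
              ∑ (allBits (suc n)) f ≡ ∑ (allBits n) (f ∘ (false ∷_)) + ∑ (allBits n) (f ∘ (true ∷_))
  ∑-allBits n f =
    trans (∑-allVecs (false ∷ true ∷ []) n f) (cong (∑ (allBits n) (f ∘ (false ∷_)) +_) (+-identityʳ _))

  ∑-allBits-const : ∀ n c → ∑ (allBits n) (λ _ → c) ≡ 2 ^ n * c
  ∑-allBits-const zero    c = refl
  ∑-allBits-const (suc n) c = begin
    ∑ (allBits (suc n)) (λ _ → c)  ≡⟨ ∑-allBits n (λ _ → c) ⟩
    s + s                          ≡⟨ cong (λ z → z + z) (∑-allBits-const n c) ⟩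
    2 ^ n * c + 2 ^ n * c          ≡⟨ sym (*-distribʳ-+ c (2 ^ n) (2 ^ n)) ⟩
    (2 ^ n + 2 ^ n) * c            ≡⟨ cong (λ z → (2 ^ n + z) * c) (sym (+-identityʳ (2 ^ n))) ⟩
    2 ^ suc n * c                  ∎
    where
      open ≡-Reasoning
      s = ∑ (allBits n) (λ _ → c)

  -- Translation permutes F₂ⁿ: a leading `false` in `v` keeps the two halves of the enumeration, a
  -- leading `true` swaps them.
  ∑-translate : ∀ {n} (v : Row n) (f : Row n → ℕ) → ∑ (allBits n) (λ w → f (v ⊕ w)) ≡ ∑ (allBits n) f
  ∑-translate             []          f = refl
  ∑-translate {n = suc n} (false ∷ v) f = begin
    ∑ (allBits (suc n)) (λ w → f ((false ∷ v) ⊕ w))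
      ≡⟨ ∑-allBits n (λ w → f ((false ∷ v) ⊕ w)) ⟩
    ∑ (allBits n) (λ w → f (false ∷ (v ⊕ w))) + ∑ (allBits n) (λ w → f (true ∷ (v ⊕ w)))
      ≡⟨ cong₂ _+_ (∑-translate v (f ∘ (false ∷_))) (∑-translate v (f ∘ (true ∷_))) ⟩
    ∑ (allBits n) (f ∘ (false ∷_)) + ∑ (allBits n) (f ∘ (true ∷_))
      ≡⟨ sym (∑-allBits n f) ⟩
    ∑ (allBits (suc n)) f ∎
    where open ≡-Reasoning
  ∑-translate {n = suc n} (true ∷ v)  f = begin
    ∑ (allBits (suc n)) (λ w → f ((true ∷ v) ⊕ w))
      ≡⟨ ∑-allBits n (λ w → f ((true ∷ v) ⊕ w)) ⟩
    ∑ (allBits n) (λ w → f (true ∷ (v ⊕ w))) + ∑ (allBits n) (λ w → f (false ∷ (v ⊕ w)))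
      ≡⟨ cong₂ _+_ (∑-translate v (f ∘ (true ∷_))) (∑-translate v (f ∘ (false ∷_))) ⟩
    ∑ (allBits n) (f ∘ (true ∷_)) + ∑ (allBits n) (f ∘ (false ∷_))
      ≡⟨ +-comm (∑ (allBits n) (f ∘ (true ∷_))) _ ⟩
    ∑ (allBits n) (f ∘ (false ∷_)) + ∑ (allBits n) (f ∘ (true ∷_))
      ≡⟨ sym (∑-allBits n f) ⟩
    ∑ (allBits (suc n)) f ∎
    where open ≡-Reasoning

  ind : Bool → ℕ
  ind false = 0
  ind true  = 1

  count : ∀ {A : Set} → (A → Bool) → List A → ℕ
  count p xs = ∑ xs (ind ∘ p)

  length-filterᵇ : ∀ {A : Set} (p : A → Bool) xs → length (filterᵇ p xs) ≡ count p xs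
  length-filterᵇ p []       = refl
  length-filterᵇ p (x ∷ xs) with p x
  ... | false = length-filterᵇ p xs
  ... | true  = cong suc (length-filterᵇ p xs)

  ind-mono : ∀ {a b} → (T a → T b) → ind a ≤ ind b
  ind-mono {false}        f = z≤n
  ind-mono {true} {true}  f = ≤-refl
  ind-mono {true} {false} f = ⊥-elim (f tt)

  ind-∨-disjoint : ∀ a b → ¬ (T a × T b) → ind (a ∨ b) ≡ ind a + ind b
  ind-∨-disjoint false b     _  = refl
  ind-∨-disjoint true  false _  = refl
  ind-∨-disjoint true  true  nb = ⊥-elim (nb (tt , tt))

  -- Spans over F₂

  ⊕-assoc : ∀ {k} (x y z : Row k) → (x ⊕ y) ⊕ z ≡ x ⊕ (y ⊕ z)
  ⊕-assoc = zipWith-assoc xor-assoc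

  ⊕-comm : ∀ {k} (x y : Row k) → x ⊕ y ≡ y ⊕ x
  ⊕-comm = zipWith-comm xor-comm

  ⊕-identityˡ : ∀ {k} (x : Row k) → zeroRow k ⊕ x ≡ x
  ⊕-identityˡ = zipWith-identityˡ xor-identityˡ

  ⊕-identityʳ : ∀ {k} (x : Row k) → x ⊕ zeroRow k ≡ x
  ⊕-identityʳ = zipWith-identityʳ xor-identityʳ

  ⊕-self : ∀ {k} (x : Row k) → x ⊕ x ≡ zeroRow k
  ⊕-self []      = refl
  ⊕-self (b ∷ x) = cong₂ _∷_ (xor-same b) (⊕-self x)

  ⊕-cancelˡ : ∀ {k} (x y : Row k) → x ⊕ (x ⊕ y) ≡ y
  ⊕-cancelˡ x y = begin
    x ⊕ (x ⊕ y)       ≡⟨ sym (⊕-assoc x x y) ⟩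
    (x ⊕ x) ⊕ y       ≡⟨ cong (_⊕ y) (⊕-self x) ⟩
    zeroRow _ ⊕ y     ≡⟨ ⊕-identityˡ y ⟩
    y                 ∎
    where open ≡-Reasoning

  ⊕-leftComm : ∀ {k} (x y z : Row k) → x ⊕ (y ⊕ z) ≡ y ⊕ (x ⊕ z)
  ⊕-leftComm x y z =
    trans (sym (⊕-assoc x y z)) (trans (cong (_⊕ z) (⊕-comm x y)) (⊕-assoc y x z))

  isZero-zeroRow : ∀ k → T (isZero (zeroRow k))
  isZero-zeroRow zero    = tt
  isZero-zeroRow (suc k) = isZero-zeroRow k

  isZero⇒≡ : ∀ {k} (x : Row k) → T (isZero x) → x ≡ zeroRow k
  isZero⇒≡ []          _ = refl
  isZero⇒≡ (false ∷ x) z = cong (false ∷_) (isZero⇒≡ x z)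

  -- A combination over F₂ uses the head `v` either not at all or once. Being Boolean-valued,
  -- membership can be counted directly.
  span : ∀ {k} → List (Row k) → Row k → Bool
  span []       w = isZero w
  span (v ∷ vs) w = span vs w ∨ span vs (v ⊕ w)

  span-zero : ∀ {k} (vs : List (Row k)) → T (span vs (zeroRow k))
  span-zero {k} []   = isZero-zeroRow k
  span-zero (v ∷ vs) = ∨⁺ (inj₁ (span-zero vs))

  span-⊕ : ∀ {k} (vs : List (Row k)) x y → T (span vs x) → T (span vs y) → T (span vs (x ⊕ y))
  span-⊕ [] x y p q =
    subst (T ∘ isZero) (sym (trans (cong (_⊕ y) (isZero⇒≡ x p)) (⊕-identityˡ y))) q
  span-⊕ (v ∷ vs) x y p q with ∨⁻ {span vs x} p | ∨⁻ {span vs y} q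
  ... | inj₁ p′ | inj₁ q′ = ∨⁺ (inj₁ (span-⊕ vs x y p′ q′))
  ... | inj₂ p′ | inj₁ q′ =
    ∨⁺ {span vs (x ⊕ y)} (inj₂ (subst (T ∘ span vs) (⊕-assoc v x y) (span-⊕ vs (v ⊕ x) y p′ q′)))
  ... | inj₁ p′ | inj₂ q′ =
    ∨⁺ {span vs (x ⊕ y)} (inj₂ (subst (T ∘ span vs) (⊕-leftComm x v y) (span-⊕ vs x (v ⊕ y) p′ q′)))
  -- Both combinations use `v`, and its two copies cancel.
  ... | inj₂ p′ | inj₂ q′ = ∨⁺ (inj₁ (subst (T ∘ span vs) eq (span-⊕ vs (v ⊕ x) (v ⊕ y) p′ q′)))
    where
      eq : (v ⊕ x) ⊕ (v ⊕ y) ≡ x ⊕ y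
      eq = trans (⊕-leftComm (v ⊕ x) v y) (trans (sym (⊕-assoc v (v ⊕ x) y)) (cong (_⊕ y) (⊕-cancelˡ v x)))

  span-translate : ∀ {k} (vs : List (Row k)) v w → T (span vs v) → span vs (v ⊕ w) ≡ span vs w
  span-translate vs v w v∈ =
    T-ext (λ p → subst (T ∘ span vs) (⊕-cancelˡ v w) (span-⊕ vs v (v ⊕ w) v∈ p))
          (span-⊕ vs v w v∈)

  -- The sum of `w` and `v ⊕ w` is `v`.
  span-disjoint : ∀ {k} (vs : List (Row k)) v w → ¬ T (span vs v) → ¬ (T (span vs w) × T (span vs (v ⊕ w)))
  span-disjoint vs v w v∉ (p , q) =
    v∉ (subst (T ∘ span vs) (trans (cong (w ⊕_) (⊕-comm v w)) (⊕-cancelˡ w v)) (span-⊕ vs w (v ⊕ w) p q))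

  -- Counts the vectors outside the span of those after them. That the order of the list does not
  -- affect the result follows from `count-span`.
  dim : ∀ {k} → List (Row k) → ℕ
  dim []       = 0
  dim (v ∷ vs) = if span vs v then dim vs else suc (dim vs)

  dim-∈ : ∀ {k} (v : Row k) vs → T (span vs v) → dim (v ∷ vs) ≡ dim vs
  dim-∈ v vs p with span vs v
  ... | true = refl

  dim-∉ : ∀ {k} (v : Row k) vs → ¬ T (span vs v) → dim (v ∷ vs) ≡ suc (dim vs)
  dim-∉ v vs p with span vs v
  ... | true  = ⊥-elim (p tt)
  ... | false = refl

  span-∷-∈ : ∀ {k} (v : Row k) vs → T (span vs v) → ∀ w → span (v ∷ vs) w ≡ span vs w
  span-∷-∈ v vs p w = trans (cong (span vs w ∨_) (span-translate vs v w p)) (∨-idem _)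

  double-2^ : ∀ n → 2 ^ n + 2 ^ n ≡ 2 ^ suc n
  double-2^ n = cong (2 ^ n +_) (sym (+-identityʳ (2 ^ n)))

  count-isZero : ∀ k → count isZero (allBits k) ≡ 1
  count-isZero zero    = refl
  count-isZero (suc k) =
    trans (∑-allBits k (ind ∘ isZero)) (trans (cong₂ _+_ (count-isZero k) (∑-zero (allBits k))) refl)

  -- A vector outside the old span adds a disjoint translate of it and doubles its size. Comparisons
  -- of dimensions are reduced to comparisons of sizes through this identity.
  count-span : ∀ {k} (vs : List (Row k)) → count (span vs) (allBits k) ≡ 2 ^ dim vs
  count-span {k} []   = count-isZero k
  count-span {k} (v ∷ vs) with T? (span vs v)
  ... | yes v∈ = begin
    count (span (v ∷ vs)) (allBits k) ≡⟨ ∑-cong (allBits k) (λ w → cong ind (span-∷-∈ v vs v∈ w)) ⟩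
    count (span vs) (allBits k)       ≡⟨ count-span vs ⟩
    2 ^ dim vs                        ≡⟨ cong (2 ^_) (sym (dim-∈ v vs v∈)) ⟩
    2 ^ dim (v ∷ vs)                  ∎
    where open ≡-Reasoning
  ... | no v∉ = begin
    count (span (v ∷ vs)) (allBits k)
      ≡⟨ ∑-cong (allBits k) (λ w → ind-∨-disjoint (span vs w) _ (span-disjoint vs v w v∉)) ⟩
    ∑ (allBits k) (λ w → ind (span vs w) + ind (span vs (v ⊕ w)))
      ≡⟨ ∑-+ (allBits k) _ _ ⟩
    count (span vs) (allBits k) + ∑ (allBits k) (λ w → ind (span vs (v ⊕ w)))
      ≡⟨ cong (count (span vs) (allBits k) +_) (∑-translate v (ind ∘ span vs)) ⟩
    count (span vs) (allBits k) + count (span vs) (allBits k)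
      ≡⟨ cong (λ z → z + z) (count-span vs) ⟩
    2 ^ dim vs + 2 ^ dim vs ≡⟨ double-2^ (dim vs) ⟩
    2 ^ suc (dim vs)        ≡⟨ cong (2 ^_) (sym (dim-∉ v vs v∉)) ⟩
    2 ^ dim (v ∷ vs)        ∎
    where open ≡-Reasoning

  2^-cancel-≤ : ∀ {m n} → 2 ^ m ≤ 2 ^ n → m ≤ n
  2^-cancel-≤ {m} {n} p = ≮⇒≥ λ n<m → <⇒≱ (^-monoʳ-< 2 (s≤s (s≤s z≤n)) n<m) p

  dim-mono : ∀ {k} (us vs : List (Row k)) → (∀ w → T (span us w) → T (span vs w)) → dim us ≤ dim vs
  dim-mono {k} us vs sub =
    2^-cancel-≤ (subst₂ _≤_ (count-span us) (count-span vs) (∑-mono-≤ (allBits k) λ w → ind-mono (sub w)))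

  dim≤ : ∀ {k} (vs : List (Row k)) → dim vs ≤ k
  dim≤ {k} vs = 2^-cancel-≤ (begin
    2 ^ dim vs                  ≡⟨ sym (count-span vs) ⟩
    count (span vs) (allBits k) ≤⟨ ∑-mono-≤ (allBits k) (λ w → ind-mono {span vs w} {true} _) ⟩
    ∑ (allBits k) (λ _ → 1)     ≡⟨ ∑-allBits-const k 1 ⟩
    2 ^ k * 1                   ≡⟨ *-identityʳ (2 ^ k) ⟩
    2 ^ k                       ∎)
    where open ≤-Reasoning

  -- Orthogonality and row rank

  dot : ∀ {n} → Row n → Row n → Bool
  dot []      []      = false
  dot (a ∷ x) (b ∷ y) = (a ∧ b) xor dot x y

  xor-interchange : ∀ a b c d → (a xor b) xor (c xor d) ≡ (a xor c) xor (b xor d)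
  xor-interchange = CommutativeSemigroupProperties.interchange
    (CommutativeRing.+-commutativeSemigroup xor-∧-commutativeRing)

  dot-⊕ˡ : ∀ {n} (x y v : Row n) → dot (x ⊕ y) v ≡ dot x v xor dot y v
  dot-⊕ˡ []      []      []      = refl
  dot-⊕ˡ (a ∷ x) (b ∷ y) (c ∷ v) =
    trans (cong₂ _xor_ (∧-distribʳ-xor c a b) (dot-⊕ˡ x y v))
          (xor-interchange (a ∧ c) (b ∧ c) (dot x v) (dot y v))

  dot-comm : ∀ {n} (x y : Row n) → dot x y ≡ dot y x
  dot-comm []      []      = refl
  dot-comm (a ∷ x) (b ∷ y) = cong₂ _xor_ (∧-comm a b) (dot-comm x y)

  dot-⊕ʳ : ∀ {n} (x v w : Row n) → dot x (v ⊕ w) ≡ dot x v xor dot x w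
  dot-⊕ʳ x v w =
    trans (dot-comm x (v ⊕ w)) (trans (dot-⊕ˡ v w x) (cong₂ _xor_ (dot-comm v x) (dot-comm w x)))

  dot-zeroˡ : ∀ {n} (x : Row n) → dot (zeroRow n) x ≡ false
  dot-zeroˡ []      = refl
  dot-zeroˡ (a ∷ x) = dot-zeroˡ x

  dot-zeroʳ : ∀ {n} (x : Row n) → dot x (zeroRow n) ≡ false
  dot-zeroʳ {n} x = trans (dot-comm x (zeroRow n)) (dot-zeroˡ x)

  dot-nondegenerate : ∀ {n} (v : Row n) → ¬ T (isZero v) → ∃ λ x → dot x v ≡ true
  dot-nondegenerate []          v≠0 = ⊥-elim (v≠0 tt)
  dot-nondegenerate {suc n} (true ∷ v) _ = (true ∷ zeroRow n) , cong not (dot-zeroˡ v)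
  dot-nondegenerate (false ∷ v) v≠0 with dot-nondegenerate v v≠0
  ... | x , eq = (false ∷ x) , eq

  perp : ∀ {n} → List (Row n) → Row n → Bool
  perp []       x = true
  perp (v ∷ vs) x = not (dot x v) ∧ perp vs x

  perp-∷⁺ : ∀ {n} (v : Row n) vs x → dot x v ≡ false → T (perp vs x) → T (perp (v ∷ vs) x)
  perp-∷⁺ v vs x eq p rewrite eq = p

  perp-⊕ : ∀ {n} (vs : List (Row n)) x y → T (perp vs x) → perp vs (x ⊕ y) ≡ perp vs y
  perp-⊕ []       x y p = refl
  perp-⊕ (v ∷ vs) x y p rewrite dot-⊕ˡ x y v with dot x v
  ... | false = cong (not (dot y v) ∧_) (perp-⊕ vs x y p)

  perp-span : ∀ {n} (vs : List (Row n)) x w → T (perp vs x) → T (span vs w) → dot x w ≡ false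
  perp-span [] x w _ w∈ = trans (cong (dot x) (isZero⇒≡ w w∈)) (dot-zeroʳ x)
  perp-span (v ∷ vs) x w p w∈ with dot x v in eq | ∨⁻ {span vs w} w∈
  ... | false | inj₁ w∈′ = perp-span vs x w p w∈′
  ... | false | inj₂ w∈′ =
    trans (sym (cong (_xor dot x w) eq)) (trans (sym (dot-⊕ʳ x v w)) (perp-span vs x (v ⊕ w) p w∈′))

  -- If x separates v and y separates u ⊕ v from span us, then x, y or x ⊕ y is orthogonal to u
  -- and still separates v.
  separate : ∀ {n} (vs : List (Row n)) v → ¬ T (span vs v) → ∃ λ x → T (perp vs x) × (dot x v ≡ true)
  separate []       v v∉ with dot-nondegenerate v v∉
  ... | x , eq = x , tt , eq
  separate (u ∷ us) v v∉
    with separate us v (v∉ ∘ ∨⁺ ∘ inj₁) | separate us (u ⊕ v) (v∉ ∘ ∨⁺ {span us v} ∘ inj₂)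
  ... | x , x⊥ , xv | y , y⊥ , yuv with dot x u in xu | dot y u in yu
  ... | false | _     = x , perp-∷⁺ u us x xu x⊥ , xv
  ... | true  | false =
    y , perp-∷⁺ u us y yu y⊥ , trans (sym (trans (dot-⊕ʳ y u v) (cong (_xor dot y v) yu))) yuv
  ... | true  | true  =
      x ⊕ y
    , perp-∷⁺ u us (x ⊕ y) (trans (dot-⊕ˡ x y u) (cong₂ _xor_ xu yu)) (subst T (sym (perp-⊕ us x y x⊥)) y⊥)
    , trans (dot-⊕ˡ x y v) (trans (cong (_xor dot y v) xv)
        (trans (sym (trans (dot-⊕ʳ y u v) (cong (_xor dot y v) yu))) yuv))

  ind-split : ∀ a b → ind (not a ∧ b) + ind (a ∧ b) ≡ ind b
  ind-split false b = +-identityʳ (ind b)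
  ind-split true  b = refl

  -- A vector `x` orthogonal to `vs` but not to `v` acts by translation on the complement of `vs`,
  -- exchanging the vectors orthogonal to `v` with the others.
  count-perp-halve : ∀ {n} (vs : List (Row n)) v → ¬ T (span vs v) →
                     2 * count (perp (v ∷ vs)) (allBits n) ≡ count (perp vs) (allBits n)
  count-perp-halve {n} vs v v∉ with separate vs v v∉
  ... | x , x⊥ , xv = begin
    2 * c                 ≡⟨ cong (c +_) (+-identityʳ c) ⟩
    c + c                 ≡⟨ cong (c +_) (sym (∑-translate x (ind ∘ perp (v ∷ vs)))) ⟩
    c + ∑ (allBits n) (λ y → ind (perp (v ∷ vs) (x ⊕ y)))
      ≡⟨ cong (c +_) (∑-cong (allBits n) λ y → cong ind (flip y)) ⟩
    c + ∑ (allBits n) (λ y → ind (dot y v ∧ perp vs y))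
      ≡⟨ sym (∑-+ (allBits n) _ _) ⟩
    ∑ (allBits n) (λ y → ind (not (dot y v) ∧ perp vs y) + ind (dot y v ∧ perp vs y))
      ≡⟨ ∑-cong (allBits n) (λ y → ind-split (dot y v) (perp vs y)) ⟩
    count (perp vs) (allBits n) ∎
    where
      open ≡-Reasoning
      c = count (perp (v ∷ vs)) (allBits n)
      flip : ∀ y → perp (v ∷ vs) (x ⊕ y) ≡ dot y v ∧ perp vs y
      flip y = cong₂ _∧_
        (trans (cong not (trans (dot-⊕ˡ x y v) (cong (_xor dot y v) xv))) (not-involutive (dot y v)))
        (perp-⊕ vs x y x⊥)

  perp-∷-∈ : ∀ {n} (v : Row n) vs → T (span vs v) → ∀ x → perp (v ∷ vs) x ≡ perp vs x
  perp-∷-∈ v vs v∈ x = T-ext (proj₂ ∘ ∧⁻ {not (dot x v)}) (λ p → perp-∷⁺ v vs x (perp-span vs x v p v∈) p)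

  -- Each vector outside the span of the later ones halves the complement and doubles the power of
  -- 2. The product form avoids the subtraction `n ∸ dim vs`.
  count-perp : ∀ {n} (vs : List (Row n)) → 2 ^ dim vs * count (perp vs) (allBits n) ≡ 2 ^ n
  count-perp {n} [] =
    trans (*-identityˡ (∑ (allBits n) (λ _ → 1))) (trans (∑-allBits-const n 1) (*-identityʳ (2 ^ n)))
  count-perp {n} (v ∷ vs) with T? (span vs v)
  ... | yes v∈ = trans
    (cong₂ (λ a b → 2 ^ a * b) (dim-∈ v vs v∈) (∑-cong (allBits n) λ x → cong ind (perp-∷-∈ v vs v∈ x)))
    (count-perp vs)
  ... | no v∉ = begin
    2 ^ dim (v ∷ vs) * c  ≡⟨ cong (λ a → 2 ^ a * c) (dim-∉ v vs v∉) ⟩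
    2 * 2 ^ dim vs * c    ≡⟨ cong (_* c) (*-comm 2 (2 ^ dim vs)) ⟩
    2 ^ dim vs * 2 * c    ≡⟨ *-assoc (2 ^ dim vs) 2 c ⟩
    2 ^ dim vs * (2 * c)  ≡⟨ cong (2 ^ dim vs *_) (count-perp-halve vs v v∉) ⟩
    2 ^ dim vs * count (perp vs) (allBits n) ≡⟨ count-perp vs ⟩
    2 ^ n                 ∎
    where
      open ≡-Reasoning
      c = count (perp (v ∷ vs)) (allBits n)

  comb : ∀ {m k} → Row m → Vec (Row k) m → Row k
  comb {k = k} []          []       = zeroRow k
  comb         (false ∷ c) (r ∷ rs) = comb c rs
  comb         (true ∷ c)  (r ∷ rs) = r ⊕ comb c rs

  -- Only the kernel, `w = 0`, is used below, but the induction needs every right-hand side: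
  -- coefficient `true` at `r` replaces `w` by `r ⊕ w`.
  count-solutions : ∀ {m k} (rs : Vec (Row k) m) w →
                    2 ^ dim (toList rs) * count (λ c → isZero (w ⊕ comb c rs)) (allBits m)
                      ≡ 2 ^ m * ind (span (toList rs) w)
  count-solutions [] w = begin
    1 * (ind (isZero (w ⊕ zeroRow _)) + 0) ≡⟨ cong (1 *_) (+-identityʳ _) ⟩
    1 * ind (isZero (w ⊕ zeroRow _))       ≡⟨ cong (λ z → 1 * ind (isZero z)) (⊕-identityʳ w) ⟩
    1 * ind (isZero w)                     ∎
    where open ≡-Reasoning
  count-solutions {suc m} {k} (r ∷ rs) w = begin
    D′ * count (λ c → isZero (w ⊕ comb c (r ∷ rs))) (allBits (suc m))
      ≡⟨ cong (D′ *_) (∑-allBits m _) ⟩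
    D′ * (sol w + ∑ (allBits m) (λ c → ind (isZero (w ⊕ (r ⊕ comb c rs)))))
      ≡⟨ cong (λ z → D′ * (sol w + z)) (∑-cong (allBits m) λ c → cong (ind ∘ isZero) (regroup (comb c rs))) ⟩
    D′ * (sol w + sol (r ⊕ w))
      ≡⟨ step (T? (span vs r)) ⟩
    2 ^ suc m * ind (span (r ∷ vs) w) ∎
    where
      open ≡-Reasoning
      vs = toList rs
      D  = 2 ^ dim vs
      D′ = 2 ^ dim (r ∷ vs)
      sol : Row k → ℕ
      sol u = count (λ c → isZero (u ⊕ comb c rs)) (allBits m)
      regroup : ∀ z → w ⊕ (r ⊕ z) ≡ (r ⊕ w) ⊕ z
      regroup z = trans (⊕-leftComm w r z) (sym (⊕-assoc r w z))
      rec : D * (sol w + sol (r ⊕ w)) ≡ 2 ^ m * (ind (span vs w) + ind (span vs (r ⊕ w)))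
      rec = begin
        D * (sol w + sol (r ⊕ w))        ≡⟨ *-distribˡ-+ D _ _ ⟩
        D * sol w + D * sol (r ⊕ w)      ≡⟨ cong₂ _+_ (count-solutions rs w) (count-solutions rs (r ⊕ w)) ⟩
        2 ^ m * ind (span vs w) + 2 ^ m * ind (span vs (r ⊕ w)) ≡⟨ sym (*-distribˡ-+ (2 ^ m) _ _) ⟩
        2 ^ m * (ind (span vs w) + ind (span vs (r ⊕ w))) ∎
      step : Dec (T (span vs r)) → D′ * (sol w + sol (r ⊕ w)) ≡ 2 ^ suc m * ind (span (r ∷ vs) w)
      step (yes r∈) = begin
        D′ * (sol w + sol (r ⊕ w))  ≡⟨ cong (λ z → 2 ^ z * (sol w + sol (r ⊕ w))) (dim-∈ r vs r∈) ⟩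
        D * (sol w + sol (r ⊕ w))   ≡⟨ rec ⟩
        2 ^ m * (ind (span vs w) + ind (span vs (r ⊕ w)))
          ≡⟨ cong (λ z → 2 ^ m * (ind (span vs w) + ind z)) (span-translate vs r w r∈) ⟩
        2 ^ m * (ind (span vs w) + ind (span vs w))
          ≡⟨ cong (λ z → 2 ^ m * (ind (span vs w) + z)) (sym (+-identityʳ _)) ⟩
        2 ^ m * (2 * ind (span vs w))  ≡⟨ sym (*-assoc (2 ^ m) 2 _) ⟩
        2 ^ m * 2 * ind (span vs w)    ≡⟨ cong (_* ind (span vs w)) (*-comm (2 ^ m) 2) ⟩
        2 ^ suc m * ind (span vs w)    ≡⟨ cong (λ z → 2 ^ suc m * ind z) (sym (span-∷-∈ r vs r∈ w)) ⟩
        2 ^ suc m * ind (span (r ∷ vs) w) ∎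
      step (no r∉) = begin
        D′ * (sol w + sol (r ⊕ w))       ≡⟨ cong (λ z → 2 ^ z * (sol w + sol (r ⊕ w))) (dim-∉ r vs r∉) ⟩
        2 * D * (sol w + sol (r ⊕ w))    ≡⟨ *-assoc 2 D _ ⟩
        2 * (D * (sol w + sol (r ⊕ w)))  ≡⟨ cong (2 *_) rec ⟩
        2 * (2 ^ m * (ind (span vs w) + ind (span vs (r ⊕ w)))) ≡⟨ sym (*-assoc 2 (2 ^ m) _) ⟩
        2 ^ suc m * (ind (span vs w) + ind (span vs (r ⊕ w)))
          ≡⟨ cong (2 ^ suc m *_) (sym (ind-∨-disjoint (span vs w) _ (span-disjoint vs r w r∉))) ⟩
        2 ^ suc m * ind (span (r ∷ vs) w) ∎

  count-kernel : ∀ {m k} (rs : Vec (Row k) m) →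
                 2 ^ dim (toList rs) * count (λ c → isZero (comb c rs)) (allBits m) ≡ 2 ^ m
  count-kernel {m} {k} rs = begin
    2 ^ dim (toList rs) * count (λ c → isZero (comb c rs)) (allBits m)
      ≡⟨ cong (2 ^ dim (toList rs) *_)
           (∑-cong (allBits m) λ c → cong (ind ∘ isZero) (sym (⊕-identityˡ (comb c rs)))) ⟩
    2 ^ dim (toList rs) * count (λ c → isZero (zeroRow k ⊕ comb c rs)) (allBits m)
      ≡⟨ count-solutions rs (zeroRow k) ⟩
    2 ^ m * ind (span (toList rs) (zeroRow k))
      ≡⟨ cong (λ b → 2 ^ m * ind b) (T-ext {b = true} _ (λ _ → span-zero (toList rs))) ⟩
    2 ^ m * 1  ≡⟨ *-identityʳ (2 ^ m) ⟩
    2 ^ m      ∎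
    where open ≡-Reasoning

  transpose : ∀ {m k} → Vec (Row m) k → Vec (Row k) m
  transpose {m} []       = replicate m []
  transpose     (c ∷ cs) = zipWith _∷_ c (transpose cs)

  comb-columns : ∀ {m k} (x c : Row m) (rs : Vec (Row k) m) → comb x (zipWith _∷_ c rs) ≡ dot x c ∷ comb x rs
  comb-columns []          []      []       = refl
  comb-columns (false ∷ x) (b ∷ c) (r ∷ rs) = comb-columns x c rs
  comb-columns (true ∷ x)  (b ∷ c) (r ∷ rs) = cong ((b ∷ r) ⊕_) (comb-columns x c rs)

  -- The coordinates of `comb x (transpose cs)` are the dot products of `x` with the members of
  -- `cs`.
  isZero-comb-transpose : ∀ {m k} (cs : Vec (Row m) k) x → isZero (comb x (transpose cs)) ≡ perp (toList cs) x
  isZero-comb-transpose []       x with [] ← comb x (transpose []) = refl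
  isZero-comb-transpose (c ∷ cs) x =
    trans (cong isZero (comb-columns x c (transpose cs))) (cong (not (dot x c) ∧_) (isZero-comb-transpose cs x))

  2^-injective : ∀ {m n} → 2 ^ m ≡ 2 ^ n → m ≡ n
  2^-injective eq = ≤-antisym (2^-cancel-≤ (≤-reflexive eq)) (2^-cancel-≤ (≤-reflexive (sym eq)))

  -- The relations among the rows are the vectors orthogonal to all columns. One set is thus counted
  -- twice, by `count-kernel` through the row rank and by `count-perp` through the column rank.
  dim-transpose : ∀ {m k} (cs : Vec (Row m) k) → dim (toList (transpose cs)) ≡ dim (toList cs)
  dim-transpose {m} cs = 2^-injective (*-cancelʳ-≡ _ _ κ (begin
      2 ^ dim (toList (transpose cs)) * κ
        ≡⟨ cong (2 ^ dim (toList (transpose cs)) *_)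
             (∑-cong (allBits m) λ x → cong ind (sym (isZero-comb-transpose cs x))) ⟩
      2 ^ dim (toList (transpose cs)) * count (λ x → isZero (comb x (transpose cs))) (allBits m)
        ≡⟨ count-kernel (transpose cs) ⟩
      2 ^ m
        ≡⟨ sym (count-perp (toList cs)) ⟩
      2 ^ dim (toList cs) * κ ∎))
    where
      open ≡-Reasoning
      κ = count (perp (toList cs)) (allBits m)
      -- `κ` is a factor of `2 ^ m`, hence nonzero and cancellable.
      instance
        κ≢0 : NonZero κ
        κ≢0 = m*n≢0⇒n≢0 (2 ^ dim (toList cs)) {{subst NonZero (sym (count-perp (toList cs))) (m^n≢0 2 m)}}

  -- Rank as the largest size of an independent sublist

  allB-++ : ∀ {A : Set} (p : A → Bool) xs ys → allB p (xs ++ ys) ≡ allB p xs ∧ allB p ys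
  allB-++ p []       ys = refl
  allB-++ p (x ∷ xs) ys = trans (cong (p x ∧_) (allB-++ p xs ys)) (sym (∧-assoc (p x) _ _))

  allB-map : ∀ {A B : Set} (p : B → Bool) (h : A → B) xs → allB p (map h xs) ≡ allB (p ∘ h) xs
  allB-map p h []       = refl
  allB-map p h (x ∷ xs) = cong (p (h x) ∧_) (allB-map p h xs)

  allB-cong : ∀ {A : Set} {p q : A → Bool} → (∀ x → p x ≡ q x) → ∀ xs → allB p xs ≡ allB q xs
  allB-cong eq []       = refl
  allB-cong eq (x ∷ xs) = cong₂ _∧_ (eq x) (allB-cong eq xs)

  not-∨ : ∀ a b → not (a ∨ b) ≡ not a ∧ not b
  not-∨ false b = refl
  not-∨ true  b = refl

  -- The offset `w` carries the induction, since including `r` turns it into `r ⊕ w`. With `w` a new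
  -- head row, the sums are those of the sublists that contain this row.
  allB-sublists : ∀ {k} (s : List (Row k)) w →
                  allB (λ x → not (isZero (w ⊕ sumRows x))) (sublists s) ≡ not (span s w)
  allB-sublists []      w = trans (∧-identityʳ _) (cong (not ∘ isZero) (⊕-identityʳ w))
  allB-sublists (r ∷ s) w = begin
    allB P (sublists s ++ map (r ∷_) (sublists s))
      ≡⟨ allB-++ P (sublists s) _ ⟩
    allB P (sublists s) ∧ allB P (map (r ∷_) (sublists s))
      ≡⟨ cong (allB P (sublists s) ∧_) (allB-map P (r ∷_) (sublists s)) ⟩
    allB P (sublists s) ∧ allB (λ x → not (isZero (w ⊕ (r ⊕ sumRows x)))) (sublists s)
      ≡⟨ cong (allB P (sublists s) ∧_) (allB-cong (λ x → cong (not ∘ isZero) (regroup (sumRows x))) (sublists s)) ⟩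
    allB P (sublists s) ∧ allB (λ x → not (isZero ((r ⊕ w) ⊕ sumRows x))) (sublists s)
      ≡⟨ cong₂ _∧_ (allB-sublists s w) (allB-sublists s (r ⊕ w)) ⟩
    not (span s w) ∧ not (span s (r ⊕ w))
      ≡⟨ sym (not-∨ (span s w) _) ⟩
    not (span (r ∷ s) w) ∎
    where
      open ≡-Reasoning
      P = λ x → not (isZero (w ⊕ sumRows x))
      regroup : ∀ z → w ⊕ (r ⊕ z) ≡ (r ⊕ w) ⊕ z
      regroup z = trans (⊕-leftComm w r z) (sym (⊕-assoc r w z))

  independent-∷ : ∀ {k} (r : Row k) s → independent (r ∷ s) ≡ independent s ∧ not (span s r)
  independent-∷ r s =
    trans (allB-++ _ (sublists s) (map (r ∷_) (sublists s)))
          (cong (independent s ∧_) (trans (allB-map _ (r ∷_) (sublists s)) (allB-sublists s r)))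

  dim-independent : ∀ {k} (s : List (Row k)) → T (independent s) → dim s ≡ length s
  dim-independent []      _ = refl
  dim-independent (r ∷ s) p with ∧⁻ {independent s} (subst T (independent-∷ r s) p)
  ... | ps , r∉ with span s r
  ... | false = cong suc (dim-independent s ps)

  span-sublist : ∀ {k} (rs : List (Row k)) {s} → s ∈ sublists rs → ∀ w → T (span s w) → T (span rs w)
  span-sublist []       (here refl) w p = p
  span-sublist (r ∷ rs) s∈ w p with ∈-++⁻ (sublists rs) s∈
  ... | inj₁ s∈′ = ∨⁺ (inj₁ (span-sublist rs s∈′ w p))
  ... | inj₂ s∈′ with ∈-map⁻ (r ∷_) s∈′
  ... | s′ , s′∈ , refl with ∨⁻ {span s′ w} p
  ... | inj₁ q = ∨⁺ (inj₁ (span-sublist rs s′∈ w q))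
  ... | inj₂ q = ∨⁺ {span rs w} (inj₂ (span-sublist rs s′∈ (r ⊕ w) q))

  basis : ∀ {k} → List (Row k) → List (Row k)
  basis []       = []
  basis (r ∷ rs) = if span rs r then basis rs else r ∷ basis rs

  span-basis : ∀ {k} (rs : List (Row k)) w → span (basis rs) w ≡ span rs w
  span-basis []       w = refl
  span-basis (r ∷ rs) w with span rs r in eq
  ... | false = cong₂ _∨_ (span-basis rs w) (span-basis rs (r ⊕ w))
  ... | true  = trans (span-basis rs w) (sym (span-∷-∈ r rs (subst T (sym eq) tt) w))

  length-basis : ∀ {k} (rs : List (Row k)) → length (basis rs) ≡ dim rs
  length-basis []       = refl
  length-basis (r ∷ rs) with span rs r
  ... | false = cong suc (length-basis rs)
  ... | true  = length-basis rs

  basis∈sublists : ∀ {k} (rs : List (Row k)) → basis rs ∈ sublists rs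
  basis∈sublists []       = here refl
  basis∈sublists (r ∷ rs) with span rs r
  ... | false = ∈-++⁺ʳ (sublists rs) (∈-map⁺ (r ∷_) (basis∈sublists rs))
  ... | true  = ∈-++⁺ˡ (basis∈sublists rs)

  independent-basis : ∀ {k} (rs : List (Row k)) → T (independent (basis rs))
  independent-basis []       = tt
  independent-basis (r ∷ rs) with span rs r in eq
  ... | true  = independent-basis rs
  ... | false = subst T (sym (independent-∷ r (basis rs)))
    (∧⁺ (independent-basis rs , subst (T ∘ not) (sym (trans (span-basis rs r) eq)) tt))

  ≤-maximum : ∀ {x xs} → x ∈ xs → x ≤ maximum xs
  ≤-maximum {xs = y ∷ ys} (here refl) = m≤m⊔n y (maximum ys)
  ≤-maximum {xs = y ∷ ys} (there p)   = ≤-trans (≤-maximum p) (m≤n⊔m y (maximum ys))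

  maximum-≤ : ∀ {m} xs → (∀ {x} → x ∈ xs → x ≤ m) → maximum xs ≤ m
  maximum-≤ []       h = z≤n
  maximum-≤ (x ∷ xs) h = ⊔-lub (h (here refl)) (maximum-≤ xs (h ∘ there))

  -- The sublist `basis rs` is independent of size `dim rs`; conversely the length of an independent
  -- sublist is its dimension, which is bounded because its span lies in that of `rs`.
  rank≡dim : ∀ {k} (rs : List (Row k)) → rank rs ≡ dim rs
  rank≡dim rs = ≤-antisym (maximum-≤ _ upper) (subst (_≤ rank rs) (length-basis rs) (≤-maximum
      (∈-map⁺ length (∈-filter⁺ (T? ∘ independent) (basis∈sublists rs) (independent-basis rs)))))
    where
      upper : ∀ {x} → x ∈ map length (filterᵇ independent (sublists rs)) → x ≤ dim rs
      upper x∈ with ∈-map⁻ length x∈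
      ... | s , s∈ , refl with ∈-filter⁻ (T? ∘ independent) {xs = sublists rs} s∈
      ... | s∈′ , ind = subst (_≤ dim rs) (dim-independent s ind) (dim-mono s rs (span-sublist rs s∈′))

  rank-transpose : ∀ {m k} (cs : Vec (Row m) k) → rank (toList (transpose cs)) ≡ dim (toList cs)
  rank-transpose cs = trans (rank≡dim (toList (transpose cs))) (dim-transpose cs)

  -- Spans of consecutive pairs

  -- By recursion, unlike `n + n`, this reduces to two successors, as the types of `interleave` and
  -- `blocks` require.
  double : ℕ → ℕ
  double zero    = zero
  double (suc n) = suc (suc (double n))

  -- Encodes a pair of vectors. Alternating coordinates, rather than concatenation, matches the rows
  -- of the stacked blocks with two rows each.
  interleave : ∀ {n} → Row n → Row n → Row (double n)
  interleave []      []      = []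
  interleave (a ∷ x) (b ∷ y) = a ∷ b ∷ interleave x y

  interleave-⊕ : ∀ {n} (a b c d : Row n) → interleave a b ⊕ interleave c d ≡ interleave (a ⊕ c) (b ⊕ d)
  interleave-⊕ []      []      []      []      = refl
  interleave-⊕ (_ ∷ a) (_ ∷ b) (_ ∷ c) (_ ∷ d) = cong (λ z → _ ∷ _ ∷ z) (interleave-⊕ a b c d)

  interleave-zero : ∀ n → interleave (zeroRow n) (zeroRow n) ≡ zeroRow (double n)
  interleave-zero zero    = refl
  interleave-zero (suc n) = cong (λ z → false ∷ false ∷ z) (interleave-zero n)

  isZero-interleave : ∀ {n} (a b : Row n) → T (isZero (interleave a b)) → T (isZero a) × T (isZero b)
  isZero-interleave []          []          _ = tt , tt
  isZero-interleave (false ∷ a) (false ∷ b) z = isZero-interleave a b z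

  ∑-interleave : ∀ n (f : Row (double n) → ℕ) →
                 ∑ (allBits (double n)) f ≡ ∑ (allBits n) (λ y → ∑ (allBits n) (λ x → f (interleave x y)))
  ∑-interleave zero    f = sym (+-identityʳ (f [] + 0))
  ∑-interleave (suc n) f = begin
    ∑ (allBits (suc (suc (double n)))) f
      ≡⟨ ∑-allBits (suc (double n)) f ⟩
    ∑ (allBits (suc (double n))) (f ∘ (false ∷_)) + ∑ (allBits (suc (double n))) (f ∘ (true ∷_))
      ≡⟨ cong₂ _+_ (∑-allBits (double n) (f ∘ (false ∷_))) (∑-allBits (double n) (f ∘ (true ∷_))) ⟩
    (S false false + S false true) + (S true false + S true true)
      ≡⟨ +-interchange (S false false) _ _ _ ⟩
    (S false false + S true false) + (S false true + S true true)
      ≡⟨ cong₂ _+_ (half false) (half true) ⟩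
    ∑ (allBits n) (λ y → ∑ (allBits (suc n)) (λ x → f (interleave x (false ∷ y))))
      + ∑ (allBits n) (λ y → ∑ (allBits (suc n)) (λ x → f (interleave x (true ∷ y))))
      ≡⟨ sym (∑-allBits n _) ⟩
    ∑ (allBits (suc n)) (λ y → ∑ (allBits (suc n)) (λ x → f (interleave x y))) ∎
    where
      open ≡-Reasoning
      S : Bool → Bool → ℕ
      S a b = ∑ (allBits (double n)) (λ z → f (a ∷ b ∷ z))
      half : ∀ b → S false b + S true b
                   ≡ ∑ (allBits n) (λ y → ∑ (allBits (suc n)) (λ x → f (interleave x (b ∷ y))))
      half b = begin
        S false b + S true b
          ≡⟨ cong₂ _+_ (∑-interleave n _) (∑-interleave n _) ⟩
        ∑ (allBits n) (λ y → ∑ (allBits n) (λ x → f (false ∷ b ∷ interleave x y)))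
          + ∑ (allBits n) (λ y → ∑ (allBits n) (λ x → f (true ∷ b ∷ interleave x y)))
          ≡⟨ sym (∑-+ (allBits n) _ _) ⟩
        ∑ (allBits n) (λ y → ∑ (allBits n) (λ x → f (false ∷ b ∷ interleave x y))
                           + ∑ (allBits n) (λ x → f (true ∷ b ∷ interleave x y)))
          ≡⟨ ∑-cong (allBits n) (λ y → sym (∑-allBits n _)) ⟩
        ∑ (allBits n) (λ y → ∑ (allBits (suc n)) (λ x → f (interleave x (b ∷ y)))) ∎

  pairs : ∀ {n k} → Vec (Row n) (suc k) → Vec (Row (double n)) k
  pairs (a ∷ [])    = []
  pairs (a ∷ b ∷ s) = interleave a b ∷ pairs (b ∷ s)

  pairSpan : ∀ {n k} → Vec (Row n) (suc k) → Row n → Row n → Bool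
  pairSpan s x y = span (toList (pairs s)) (interleave x y)

  pairSpan-∷⁻ : ∀ {n k} (a b : Row n) (s : Vec (Row n) k) x y → T (pairSpan (a ∷ b ∷ s) x y) →
                T (pairSpan (b ∷ s) x y) ⊎ T (pairSpan (b ∷ s) (a ⊕ x) (b ⊕ y))
  pairSpan-∷⁻ a b s x y p with ∨⁻ {pairSpan (b ∷ s) x y} p
  ... | inj₁ q = inj₁ q
  ... | inj₂ q = inj₂ (subst (T ∘ span (toList (pairs (b ∷ s)))) (interleave-⊕ a b x y) q)

  pairSpan⇒span : ∀ {n k} (b : Row n) (s : Vec (Row n) k) x y →
                  T (pairSpan (b ∷ s) x y) → T (span (b ∷ toList s) x) × T (span (toList s) y)
  pairSpan⇒span b []      x y p with isZero-interleave x y p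
  ... | x0 , y0 = ∨⁺ (inj₁ x0) , y0
  pairSpan⇒span a (b ∷ s) x y p with pairSpan-∷⁻ a b s x y p
  ... | inj₁ q with pairSpan⇒span b s x y q
  ...   | x∈ , y∈ = ∨⁺ (inj₁ x∈) , ∨⁺ (inj₁ y∈)
  pairSpan⇒span a (b ∷ s) x y p | inj₂ q with pairSpan⇒span b s (a ⊕ x) (b ⊕ y) q
  ...   | x∈ , y∈ = ∨⁺ {span (b ∷ toList s) x} (inj₂ x∈) , ∨⁺ {span (toList s) y} (inj₂ y∈)

  -- The combination that gives `y` from the second components, applied to the whole pairs, also
  -- produces the required first component.
  span⇒pairSpan : ∀ {n k} (b : Row n) (s : Vec (Row n) k) y →
                  T (span (toList s) y) → ∃ λ x → T (pairSpan (b ∷ s) x y)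
  span⇒pairSpan {n} b [] y p = zeroRow n , subst (T ∘ isZero)
    (sym (trans (cong (interleave (zeroRow n)) (isZero⇒≡ y p)) (interleave-zero n))) (isZero-zeroRow (double n))
  span⇒pairSpan a (b ∷ s) y p with ∨⁻ {span (toList s) y} p
  ... | inj₁ q with span⇒pairSpan b s y q
  ...   | x , x∈ = x , ∨⁺ (inj₁ x∈)
  span⇒pairSpan a (b ∷ s) y p | inj₂ q with span⇒pairSpan b s (b ⊕ y) q
  ...   | x , x∈ = a ⊕ x , ∨⁺ {pairSpan (b ∷ s) (a ⊕ x) y} (inj₂ (subst (T ∘ span (toList (pairs (b ∷ s)))) eq x∈))
    where
      eq : interleave x (b ⊕ y) ≡ interleave a b ⊕ interleave (a ⊕ x) y
      eq = sym (trans (interleave-⊕ a b (a ⊕ x) y) (cong (λ z → interleave z (b ⊕ y)) (⊕-cancelˡ a x)))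

  fibre : ∀ {n k} → Vec (Row n) (suc k) → Row n → ℕ
  fibre {n} s y = count (λ x → pairSpan s x y) (allBits n)

  -- A nonempty fibre of the second projection is a coset of the kernel, the fibre over zero; `x₀`
  -- translates one to the other.
  fibre-∈ : ∀ {n k} (b : Row n) (s : Vec (Row n) k) y → T (span (toList s) y) →
            fibre (b ∷ s) y ≡ fibre (b ∷ s) (zeroRow n)
  fibre-∈ {n} b s y y∈ with span⇒pairSpan b s y y∈
  ... | x₀ , p = begin
    fibre (b ∷ s) y
      ≡⟨ sym (∑-translate x₀ (λ x → ind (pairSpan (b ∷ s) x y))) ⟩
    ∑ (allBits n) (λ x → ind (pairSpan (b ∷ s) (x₀ ⊕ x) y))
      ≡⟨ ∑-cong (allBits n) (λ x → cong ind (shift x)) ⟩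
    fibre (b ∷ s) (zeroRow n) ∎
    where
      open ≡-Reasoning
      vs = toList (pairs (b ∷ s))
      shift : ∀ x → pairSpan (b ∷ s) (x₀ ⊕ x) y ≡ pairSpan (b ∷ s) x (zeroRow n)
      shift x = begin
        span vs (interleave (x₀ ⊕ x) y)
          ≡⟨ cong (span vs ∘ interleave (x₀ ⊕ x)) (sym (⊕-identityʳ y)) ⟩
        span vs (interleave (x₀ ⊕ x) (y ⊕ zeroRow n))
          ≡⟨ cong (span vs) (sym (interleave-⊕ x₀ y x (zeroRow n))) ⟩
        span vs (interleave x₀ y ⊕ interleave x (zeroRow n))
          ≡⟨ span-translate vs _ _ p ⟩
        span vs (interleave x (zeroRow n)) ∎

  ind-false : ∀ {b} → ¬ T b → ind b ≡ 0
  ind-false {false} _ = refl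
  ind-false {true}  p = ⊥-elim (p tt)

  fibre-∉ : ∀ {n k} (b : Row n) (s : Vec (Row n) k) y → ¬ T (span (toList s) y) → fibre (b ∷ s) y ≡ 0
  fibre-∉ {n} b s y y∉ = trans
    (∑-cong (allBits n) λ x → ind-false (y∉ ∘ proj₂ ∘ pairSpan⇒span b s x y)) (∑-zero (allBits n))

  fibre-total : ∀ {n k} (b : Row n) (s : Vec (Row n) k) →
                2 ^ dim (toList (pairs (b ∷ s))) ≡ 2 ^ dim (toList s) * fibre (b ∷ s) (zeroRow n)
  fibre-total {n} b s = begin
    2 ^ dim (toList (pairs (b ∷ s)))        ≡⟨ sym (count-span (toList (pairs (b ∷ s)))) ⟩
    count (span (toList (pairs (b ∷ s)))) (allBits (double n)) ≡⟨ ∑-interleave n _ ⟩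
    ∑ (allBits n) (fibre (b ∷ s))           ≡⟨ ∑-cong (allBits n) each ⟩
    ∑ (allBits n) (λ y → ind (span (toList s) y) * Z) ≡⟨ ∑-*ʳ (allBits n) Z _ ⟩
    count (span (toList s)) (allBits n) * Z ≡⟨ cong (_* Z) (count-span (toList s)) ⟩
    2 ^ dim (toList s) * Z                  ∎
    where
      open ≡-Reasoning
      Z = fibre (b ∷ s) (zeroRow n)
      each : ∀ y → fibre (b ∷ s) y ≡ ind (span (toList s) y) * Z
      each y with T? (span (toList s) y)
      ... | yes y∈ = trans (fibre-∈ b s y y∈)
        (sym (trans (cong (λ e → ind e * Z) (T-ext {b = true} _ (λ _ → y∈))) (+-identityʳ Z)))
      ... | no  y∉ = trans (fibre-∉ b s y y∉) (sym (cong (_* Z) (ind-false y∉)))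

  2^-quotient : ∀ r d z → 2 ^ r ≡ 2 ^ d * z → z ≡ 2 ^ (r ∸ d)
  2^-quotient r d z eq = *-cancelˡ-≡ z (2 ^ (r ∸ d)) (2 ^ d) {{m^n≢0 2 d}} (begin
    2 ^ d * z              ≡⟨ sym eq ⟩
    2 ^ r                  ≡⟨ cong (2 ^_) (sym (m+[n∸m]≡n d≤r)) ⟩
    2 ^ (d + (r ∸ d))      ≡⟨ ^-distribˡ-+-* 2 d (r ∸ d) ⟩
    2 ^ d * 2 ^ (r ∸ d)    ∎)
    where
      open ≡-Reasoning
      z≢0 : NonZero z
      z≢0 = m*n≢0⇒n≢0 (2 ^ d) {{subst NonZero eq (m^n≢0 2 r)}}
      -- `z` is nonzero, so `2 ^ d ≤ 2 ^ r`; hence the truncated difference `r ∸ d` is the true one.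
      d≤r : d ≤ r
      d≤r = 2^-cancel-≤ (subst (2 ^ d ≤_) (sym eq) (m≤m*n (2 ^ d) z {{z≢0}}))

  fibre-size : ∀ {n k} (b : Row n) (s : Vec (Row n) k) y → T (span (toList s) y) →
               fibre (b ∷ s) y ≡ 2 ^ (dim (toList (pairs (b ∷ s))) ∸ dim (toList s))
  fibre-size b s y y∈ =
    trans (fibre-∈ b s y y∈) (2^-quotient (dim (toList (pairs (b ∷ s)))) (dim (toList s)) _ (fibre-total b s))

  -- States and the effect of prepending a term

  State : Set
  State = ℕ × ℕ × Bool

  state : ∀ {n k} → Vec (Row n) (suc k) → State
  state (b ∷ s) = dim (toList (pairs (b ∷ s))) , dim (toList s) , span (toList s) b

  -- Sums g over the states reached by prepending one of the 2ⁿ vectors.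
  transfer : ℕ → (State → ℕ) → State → ℕ
  transfer n g (r , d , true)  =
    2 ^ (r ∸ d) * g (r , d , true)
      + ((2 ^ d ∸ 2 ^ (r ∸ d)) * g (suc r , d , true) + (2 ^ n ∸ 2 ^ d) * g (suc r , d , false))
  transfer n g (r , d , false) =
    2 ^ suc d * g (suc r , suc d , true) + (2 ^ n ∸ 2 ^ suc d) * g (suc r , suc d , false)

  count-not : ∀ n (p : Row n → Bool) c → count p (allBits n) ≡ c → count (not ∘ p) (allBits n) ≡ 2 ^ n ∸ c
  count-not n p c eq = begin
    N                  ≡⟨ sym (m+n∸m≡n c N) ⟩
    c + N ∸ c          ≡⟨ cong (λ z → z + N ∸ c) (sym eq) ⟩
    count p (allBits n) + N ∸ c ≡⟨ cong (_∸ c) (sym (∑-+ (allBits n) _ _)) ⟩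
    ∑ (allBits n) (λ x → ind (p x) + ind (not (p x))) ∸ c ≡⟨ cong (_∸ c) (∑-cong (allBits n) (λ x → one (p x))) ⟩
    ∑ (allBits n) (λ _ → 1) ∸ c ≡⟨ cong (_∸ c) (trans (∑-allBits-const n 1) (*-identityʳ (2 ^ n))) ⟩
    2 ^ n ∸ c          ∎
    where
      open ≡-Reasoning
      N = count (not ∘ p) (allBits n)
      one : ∀ b → ind b + ind (not b) ≡ 1
      one false = refl
      one true  = refl

  count-difference : ∀ n (p q : Row n → Bool) c e → (∀ x → T (p x) → T (q x)) →
                     count p (allBits n) ≡ c → count q (allBits n) ≡ e →
                     count (λ x → not (p x) ∧ q x) (allBits n) ≡ e ∸ c
  count-difference n p q c e p⇒q refl refl = begin
    N                  ≡⟨ sym (m+n∸m≡n c N) ⟩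
    c + N ∸ c          ≡⟨ cong (_∸ c) (sym (∑-+ (allBits n) _ _)) ⟩
    ∑ (allBits n) (λ x → ind (p x) + ind (not (p x) ∧ q x)) ∸ c
      ≡⟨ cong (_∸ c) (∑-cong (allBits n) (λ x → split (p x) (q x) (p⇒q x))) ⟩
    e ∸ c              ∎
    where
      open ≡-Reasoning
      N = count (λ x → not (p x) ∧ q x) (allBits n)
      split : ∀ a b → (T a → T b) → ind a + ind (not a ∧ b) ≡ ind b
      split false b     _ = refl
      split true  true  _ = refl
      split true  false f = ⊥-elim (f tt)

  ∑-weights : ∀ n (p q : Row n → Bool) {c e} u v →
              count p (allBits n) ≡ c → count q (allBits n) ≡ e →
              ∑ (allBits n) (λ a → ind (p a) * u + ind (q a) * v) ≡ c * u + e * v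
  ∑-weights n p q u v refl refl =
    trans (∑-+ (allBits n) _ _) (cong₂ _+_ (∑-*ʳ (allBits n) u _) (∑-*ʳ (allBits n) v _))

  -- If `b` lies in the span U of `s`, then U does not grow, and `a` is in the fibre over `b` (no
  -- change), in U outside the fibre (only the rank grows), or outside U (the rank grows and the
  -- flag drops). If `b` is outside U, the fibre is empty, so rank and dimension both grow, and only
  -- membership of `a` in the enlarged span remains to be recorded.
  ∑-prepend : ∀ {n k} (g : State → ℕ) (s : Vec (Row n) (suc k)) →
              ∑ (allBits n) (λ a → g (state (a ∷ s))) ≡ transfer n g (state s)
  ∑-prepend {n} g (b ∷ s) with T? (span (toList s) b)
  ... | yes b∈ = begin
    ∑ (allBits n) (λ a → g (state (a ∷ b ∷ s)))
      ≡⟨ ∑-cong (allBits n) (λ a → pointwise a (pairSpan (b ∷ s) a b) (U a) refl refl (proj₁ ∘ pairSpan⇒span b s a b)) ⟩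
    ∑ (allBits n) (λ a → ind (W a) * g (r , d , true)
      + (ind (not (W a) ∧ U a) * g (suc r , d , true) + ind (not (U a)) * g (suc r , d , false)))
      ≡⟨ ∑-+ (allBits n) _ _ ⟩
    ∑ (allBits n) (λ a → ind (W a) * g (r , d , true))
      + ∑ (allBits n) (λ a → ind (not (W a) ∧ U a) * g (suc r , d , true) + ind (not (U a)) * g (suc r , d , false))
      ≡⟨ cong₂ _+_
           (trans (∑-*ʳ (allBits n) (g (r , d , true)) (ind ∘ W)) (cong (_* g (r , d , true)) countW))
           (∑-weights n (λ a → not (W a) ∧ U a) (not ∘ U) _ _
             (count-difference n W U _ _ (λ a → proj₁ ∘ pairSpan⇒span b s a b) countW countU)
             (count-not n U _ countU)) ⟩
    transfer n g (r , d , true)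
      ≡⟨ cong (λ φ → transfer n g (r , d , φ)) (T-ext {true} {span (toList s) b} (λ _ → b∈) _) ⟩
    transfer n g (state (b ∷ s)) ∎
    where
      open ≡-Reasoning
      r = dim (toList (pairs (b ∷ s)))
      d = dim (toList s)
      W U : Row n → Bool
      W a = pairSpan (b ∷ s) a b
      U a = span (b ∷ toList s) a
      countW : count W (allBits n) ≡ 2 ^ (r ∸ d)
      countW = fibre-size b s b b∈
      countU : count U (allBits n) ≡ 2 ^ d
      countU = trans (count-span (b ∷ toList s)) (cong (2 ^_) (dim-∈ b (toList s) b∈))
      pointwise : ∀ a w u → W a ≡ w → U a ≡ u → (T (W a) → T (U a)) →
                  g (state (a ∷ b ∷ s)) ≡ ind (W a) * g (r , d , true)
                    + (ind (not (W a) ∧ U a) * g (suc r , d , true) + ind (not (U a)) * g (suc r , d , false))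
      pointwise a w u eqW eqU W⇒U rewrite dim-∈ b (toList s) b∈ | eqW | eqU = cases w u W⇒U
        where
          cases : ∀ w u → (T w → T u) → g ((if w then r else suc r) , d , u) ≡
                  ind w * g (r , d , true) + (ind (not w ∧ u) * g (suc r , d , true) + ind (not u) * g (suc r , d , false))
          cases false false _ = sym (+-identityʳ _)
          cases false true  _ = sym (trans (+-identityʳ _) (+-identityʳ _))
          cases true  true  _ = sym (trans (+-identityʳ _) (+-identityʳ _))
          cases true  false f = ⊥-elim (f tt)
  ... | no b∉ = begin
    ∑ (allBits n) (λ a → g (state (a ∷ b ∷ s)))
      ≡⟨ ∑-cong (allBits n) pointwise ⟩
    ∑ (allBits n) (λ a → ind (U a) * g (suc r , suc d , true) + ind (not (U a)) * g (suc r , suc d , false))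
      ≡⟨ ∑-weights n U (not ∘ U) _ _ countU (count-not n U _ countU) ⟩
    transfer n g (r , d , false)
      ≡⟨ cong (λ φ → transfer n g (r , d , φ)) (T-ext {false} {span (toList s) b} (λ ()) b∉) ⟩
    transfer n g (state (b ∷ s)) ∎
    where
      open ≡-Reasoning
      r = dim (toList (pairs (b ∷ s)))
      d = dim (toList s)
      U : Row n → Bool
      U a = span (b ∷ toList s) a
      countU : count U (allBits n) ≡ 2 ^ suc d
      countU = trans (count-span (b ∷ toList s)) (cong (2 ^_) (dim-∉ b (toList s) b∉))
      pointwise : ∀ a → g (state (a ∷ b ∷ s)) ≡
                  ind (U a) * g (suc r , suc d , true) + ind (not (U a)) * g (suc r , suc d , false)
      pointwise a
        rewrite dim-∉ b (toList s) b∉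
              -- A pair in the span has its second component in the span of `s`, which excludes `b`.
              | dim-∉ (interleave a b) (toList (pairs (b ∷ s))) (b∉ ∘ proj₂ ∘ pairSpan⇒span b s a b)
        with U a
      ... | true  = sym (trans (+-identityʳ _) (+-identityʳ _))
      ... | false = sym (+-identityʳ _)

  -- The recurrence

  same : Bool → Bool → Bool
  same true  b = b
  same false b = not b

  -- The flags are compared first, so that differing flags reduce to `false` whatever the numbers
  -- are.
  _==ˢ_ : State → State → Bool
  (r , d , φ) ==ˢ (r′ , d′ , φ′) = same φ φ′ ∧ ((r ≡ᵇ r′) ∧ (d ≡ᵇ d′))

  occurrences : ∀ n k → State → ℕ
  occurrences n k σ = count (λ s → state s ==ˢ σ) (allVecs (allBits n) (suc k))

  -- The transpose of transfer: the states leading to a given one, with multiplicities.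
  predecessors : ℕ → State → List (ℕ × State)
  predecessors n (zero  , d     , true)  = (2 ^ (0 ∸ d) , (0 , d , true)) ∷ []
  predecessors n (suc r , zero  , true)  =
    (2 ^ suc r , (suc r , 0 , true)) ∷ (2 ^ 0 ∸ 2 ^ r , (r , 0 , true)) ∷ []
  predecessors n (suc r , suc d , true)  =
    (2 ^ (r ∸ d) , (suc r , suc d , true)) ∷ (2 ^ suc d ∸ 2 ^ (r ∸ suc d) , (r , suc d , true))
      ∷ (2 ^ suc d , (r , d , false)) ∷ []
  predecessors n (zero  , d     , false) = []
  predecessors n (suc r , zero  , false) = (2 ^ n ∸ 2 ^ 0 , (r , 0 , true)) ∷ []
  predecessors n (suc r , suc d , false) =
    (2 ^ n ∸ 2 ^ suc d , (r , suc d , true)) ∷ (2 ^ n ∸ 2 ^ suc d , (r , d , false)) ∷ []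

  weightedSum : (State → ℕ) → List (ℕ × State) → ℕ
  weightedSum N ps = ∑ ps (λ p → proj₁ p * N (proj₂ p))

  -- `transfer` writes a multiplicity in terms of the source state, `predecessors` in terms of the
  -- target. The two expressions agree wherever the indicator is nonzero.
  move-weight : ∀ (f : ℕ → ℕ → ℕ) ρ e r d → f ρ e * ind ((ρ ≡ᵇ r) ∧ (e ≡ᵇ d)) ≡ f r d * ind ((ρ ≡ᵇ r) ∧ (e ≡ᵇ d))
  move-weight f ρ e r d with ρ ≡ᵇ r in eq | e ≡ᵇ d in eq′
  ... | false | _     = trans (*-zeroʳ (f ρ e)) (sym (*-zeroʳ (f r d)))
  ... | true  | false = trans (*-zeroʳ (f ρ e)) (sym (*-zeroʳ (f r d)))
  ... | true  | true  = cong (_* 1) (cong₂ f (≡ᵇ⇒≡ ρ r (subst T (sym eq) tt)) (≡ᵇ⇒≡ e d (subst T (sym eq′) tt)))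

  -- The flags, and whether the entries of `σ` are successors, decide which arrows from `τ` can end
  -- in `σ`; the others contribute a product with zero.
  transfer-indicator : ∀ n τ σ → transfer n (λ υ → ind (υ ==ˢ σ)) τ ≡ weightedSum (λ υ → ind (τ ==ˢ υ)) (predecessors n σ)
  transfer-indicator n (ρ , e , true) (zero , d , true)
    rewrite *-zeroʳ (2 ^ e ∸ 2 ^ (ρ ∸ e)) | *-zeroʳ (2 ^ n ∸ 2 ^ e) =
    cong (_+ 0) (move-weight (λ ρ e → 2 ^ (ρ ∸ e)) ρ e 0 d)
  transfer-indicator n (ρ , e , true) (suc r , zero , true)
    rewrite *-zeroʳ (2 ^ n ∸ 2 ^ e) =
    cong₂ _+_ (move-weight (λ ρ e → 2 ^ (ρ ∸ e)) ρ e (suc r) 0)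
              (cong (_+ 0) (move-weight (λ ρ e → 2 ^ e ∸ 2 ^ (ρ ∸ e)) ρ e r 0))
  transfer-indicator n (ρ , e , true) (suc r , suc d , true)
    rewrite *-zeroʳ (2 ^ n ∸ 2 ^ e) | *-zeroʳ (2 ^ d + (2 ^ d + 0)) =
    cong₂ _+_ (move-weight (λ ρ e → 2 ^ (ρ ∸ e)) ρ e (suc r) (suc d))
              (cong (_+ 0) (move-weight (λ ρ e → 2 ^ e ∸ 2 ^ (ρ ∸ e)) ρ e r (suc d)))
  transfer-indicator n (ρ , e , true) (zero , d , false)
    rewrite *-zeroʳ (2 ^ (ρ ∸ e)) | *-zeroʳ (2 ^ e ∸ 2 ^ (ρ ∸ e)) | *-zeroʳ (2 ^ n ∸ 2 ^ e) = refl
  transfer-indicator n (ρ , e , true) (suc r , zero , false)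
    rewrite *-zeroʳ (2 ^ (ρ ∸ e)) | *-zeroʳ (2 ^ e ∸ 2 ^ (ρ ∸ e)) =
    trans (move-weight (λ _ e → 2 ^ n ∸ 2 ^ e) ρ e r 0) (sym (+-identityʳ _))
  transfer-indicator n (ρ , e , true) (suc r , suc d , false)
    rewrite *-zeroʳ (2 ^ (ρ ∸ e)) | *-zeroʳ (2 ^ e ∸ 2 ^ (ρ ∸ e)) | *-zeroʳ (2 ^ n ∸ 2 ^ suc d) =
    trans (move-weight (λ _ e → 2 ^ n ∸ 2 ^ e) ρ e r (suc d)) (sym (+-identityʳ _))
  transfer-indicator n (ρ , e , false) (zero , d , true)
    rewrite *-zeroʳ (2 ^ suc e) | *-zeroʳ (2 ^ n ∸ 2 ^ suc e) | *-zeroʳ (2 ^ (0 ∸ d)) = refl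
  transfer-indicator n (ρ , e , false) (suc r , zero , true)
    rewrite ∧-zeroʳ (ρ ≡ᵇ r) | *-zeroʳ (2 ^ suc e) | *-zeroʳ (2 ^ n ∸ 2 ^ suc e) | *-zeroʳ (2 ^ suc r)
          | *-zeroʳ (1 ∸ 2 ^ r) = refl
  transfer-indicator n (ρ , e , false) (suc r , suc d , true)
    rewrite *-zeroʳ (2 ^ n ∸ 2 ^ suc e) | *-zeroʳ (2 ^ (r ∸ d)) | *-zeroʳ (2 ^ suc d ∸ 2 ^ (r ∸ suc d)) =
    cong (_+ 0) (move-weight (λ _ e → 2 ^ suc e) ρ e r d)
  transfer-indicator n (ρ , e , false) (zero , d , false)
    rewrite *-zeroʳ (2 ^ suc e) | *-zeroʳ (2 ^ n ∸ 2 ^ suc e) = refl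
  transfer-indicator n (ρ , e , false) (suc r , zero , false)
    rewrite ∧-zeroʳ (ρ ≡ᵇ r) | *-zeroʳ (2 ^ suc e) | *-zeroʳ (2 ^ n ∸ 2 ^ suc e) | *-zeroʳ (2 ^ n ∸ 1) = refl
  transfer-indicator n (ρ , e , false) (suc r , suc d , false)
    rewrite *-zeroʳ (2 ^ suc e) | *-zeroʳ (2 ^ n ∸ 2 ^ suc d) =
    trans (move-weight (λ _ e → 2 ^ n ∸ 2 ^ suc e) ρ e r d) (sym (+-identityʳ _))

  occurrences-suc : ∀ n k σ → occurrences n (suc k) σ ≡ weightedSum (occurrences n k) (predecessors n σ)
  occurrences-suc n k σ = begin
    occurrences n (suc k) σ
      ≡⟨ ∑-allVecs (allBits n) (suc k) _ ⟩
    ∑ (allBits n) (λ a → ∑ seqs (λ s → ind (state (a ∷ s) ==ˢ σ)))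
      ≡⟨ ∑-swap (allBits n) seqs _ ⟩
    ∑ seqs (λ s → ∑ (allBits n) (λ a → ind (state (a ∷ s) ==ˢ σ)))
      ≡⟨ ∑-cong seqs (λ s → trans (∑-prepend (λ υ → ind (υ ==ˢ σ)) s) (transfer-indicator n (state s) σ)) ⟩
    ∑ seqs (λ s → ∑ (predecessors n σ) (λ p → proj₁ p * ind (state s ==ˢ proj₂ p)))
      ≡⟨ ∑-swap seqs (predecessors n σ) _ ⟩
    ∑ (predecessors n σ) (λ p → ∑ seqs (λ s → proj₁ p * ind (state s ==ˢ proj₂ p)))
      ≡⟨ ∑-cong (predecessors n σ) (λ p → ∑-*ˡ seqs (proj₁ p) _) ⟩
    weightedSum (occurrences n k) (predecessors n σ) ∎
    where
      open ≡-Reasoning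
      seqs = allVecs (allBits n) (suc k)

  -- From four rows of length k + 1 to sequences of k + 1 vectors in F₂⁴

  ∑-transpose-column : ∀ m n (f : Vec (Row (suc m)) n → ℕ) →
    ∑ (allVecs (allBits (suc m)) n) f
      ≡ ∑ (allVecs (allBits m) n) (λ M → ∑ (allBits n) (λ c → f (zipWith _∷_ c M)))
  ∑-transpose-column m zero    f = sym (+-identityʳ (f [] + 0))
  ∑-transpose-column m (suc n) f = begin
    ∑ (allVecs (allBits (suc m)) (suc n)) f
      ≡⟨ ∑-allVecs (allBits (suc m)) n f ⟩
    ∑ (allBits (suc m)) (λ r → ∑ (allVecs (allBits (suc m)) n) (λ M → f (r ∷ M)))
      ≡⟨ ∑-allBits m _ ⟩
    ∑ (allBits m) (λ r → ∑ (allVecs (allBits (suc m)) n) (λ M → f ((false ∷ r) ∷ M)))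
      + ∑ (allBits m) (λ r → ∑ (allVecs (allBits (suc m)) n) (λ M → f ((true ∷ r) ∷ M)))
      ≡⟨ sym (∑-+ (allBits m) _ _) ⟩
    ∑ (allBits m) (λ r → ∑ (allVecs (allBits (suc m)) n) (λ M → f ((false ∷ r) ∷ M))
                       + ∑ (allVecs (allBits (suc m)) n) (λ M → f ((true ∷ r) ∷ M)))
      ≡⟨ ∑-cong (allBits m) (λ r → cong₂ _+_ (∑-transpose-column m n _) (∑-transpose-column m n _)) ⟩
    ∑ (allBits m) (λ r →
        ∑ (allVecs (allBits m) n) (λ M → ∑ (allBits n) (λ c → f ((false ∷ r) ∷ zipWith _∷_ c M)))
      + ∑ (allVecs (allBits m) n) (λ M → ∑ (allBits n) (λ c → f ((true ∷ r) ∷ zipWith _∷_ c M))))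
      ≡⟨ ∑-cong (allBits m) (λ r → trans (sym (∑-+ (allVecs (allBits m) n) _ _))
           (∑-cong (allVecs (allBits m) n) λ M → sym (∑-allBits n _))) ⟩
    ∑ (allBits m) (λ r → ∑ (allVecs (allBits m) n) (λ M → ∑ (allBits (suc n)) (λ c → f (zipWith _∷_ c (r ∷ M)))))
      ≡⟨ sym (∑-allVecs (allBits m) n _) ⟩
    ∑ (allVecs (allBits m) (suc n)) (λ M → ∑ (allBits (suc n)) (λ c → f (zipWith _∷_ c M))) ∎
    where open ≡-Reasoning

  ∑-transpose : ∀ m n (f : Vec (Row m) n → ℕ) →
                ∑ (allVecs (allBits m) n) f ≡ ∑ (allVecs (allBits n) m) (f ∘ transpose)
  ∑-transpose zero    n f = empty n f
    where
      empty : ∀ n (f : Vec (Row 0) n → ℕ) → ∑ (allVecs (allBits 0) n) f ≡ f (replicate n []) + 0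
      empty zero    f = refl
      empty (suc n) f = trans (∑-allVecs (allBits 0) n f) (trans (+-identityʳ _) (empty n (f ∘ ([] ∷_))))
  ∑-transpose (suc m) n f = begin
    ∑ (allVecs (allBits (suc m)) n) f
      ≡⟨ ∑-transpose-column m n f ⟩
    ∑ (allVecs (allBits m) n) (λ M → ∑ (allBits n) (λ c → f (zipWith _∷_ c M)))
      ≡⟨ ∑-transpose m n _ ⟩
    ∑ (allVecs (allBits n) m) (λ s → ∑ (allBits n) (λ c → f (transpose (c ∷ s))))
      ≡⟨ ∑-swap (allVecs (allBits n) m) (allBits n) _ ⟩
    ∑ (allBits n) (λ c → ∑ (allVecs (allBits n) m) (λ s → f (transpose (c ∷ s))))
      ≡⟨ sym (∑-allVecs (allBits n) m _) ⟩
    ∑ (allVecs (allBits n) (suc m)) (f ∘ transpose) ∎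
    where open ≡-Reasoning

  blocks : ∀ {n k} → Vec (Row (suc k)) n → Vec (Row k) (double n)
  blocks []       = []
  blocks (α ∷ αs) = init α ∷ tail α ∷ blocks αs

  quadMatrix≡blocks : ∀ {k} (αs : Vec (Row (suc k)) 4) → quadMatrix αs ≡ toList (blocks αs)
  quadMatrix≡blocks (_ ∷ _ ∷ _ ∷ _ ∷ []) = refl

  -- In each block `init` contributes the entry of `a` and `tail` that of `b`, so the first column
  -- is their interleaving and the rest is the same matrix without the term `a`.
  blocks-∷ : ∀ {n k} (a b : Row n) (M : Vec (Row k) n) →
             blocks (zipWith _∷_ a (zipWith _∷_ b M)) ≡ zipWith _∷_ (interleave a b) (blocks (zipWith _∷_ b M))
  blocks-∷ []      []      []      = refl
  blocks-∷ (x ∷ a) (y ∷ b) (r ∷ M) = cong (λ z → _ ∷ _ ∷ z) (blocks-∷ a b M)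

  blocks-transpose : ∀ {n k} (s : Vec (Row n) (suc k)) → blocks (transpose s) ≡ transpose (pairs s)
  blocks-transpose (a ∷ [])    = single a
    where
      single : ∀ {n} (a : Row n) → blocks (zipWith _∷_ a (replicate n [])) ≡ replicate (double n) []
      single []      = refl
      single (x ∷ a) = cong (λ z → [] ∷ [] ∷ z) (single a)
  blocks-transpose (a ∷ b ∷ s) =
    trans (blocks-∷ a b (transpose s)) (cong (zipWith _∷_ (interleave a b)) (blocks-transpose (b ∷ s)))

  rank-quadMatrix : ∀ {k} (s : Vec (Row 4) (suc k)) → rank (quadMatrix (transpose s)) ≡ proj₁ (state s)
  rank-quadMatrix s@(_ ∷ _) = begin
    rank (quadMatrix (transpose s))         ≡⟨ cong rank (quadMatrix≡blocks (transpose s)) ⟩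
    rank (toList (blocks (transpose s)))    ≡⟨ cong (rank ∘ toList) (blocks-transpose s) ⟩
    rank (toList (transpose (pairs s)))     ≡⟨ rank-transpose (pairs s) ⟩
    dim (toList (pairs s))                  ∎
    where open ≡-Reasoning

  -- The second entry stops at 4, because U lies in F₂⁴.
  states : ℕ → List State
  states r = (r , 0 , true) ∷ (r , 0 , false) ∷ (r , 1 , true) ∷ (r , 1 , false) ∷ (r , 2 , true)
           ∷ (r , 2 , false) ∷ (r , 3 , true) ∷ (r , 3 , false) ∷ (r , 4 , true) ∷ (r , 4 , false) ∷ []

  ind-rank : ∀ i ρ e φ → e ≤ 4 → ind (ρ ≡ᵇ i) ≡ ∑ (states i) (λ σ → ind ((ρ , e , φ) ==ˢ σ))
  ind-rank i ρ e φ e≤4 with ρ ≡ᵇ i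
  ind-rank i ρ 0 true  _ | true = refl
  ind-rank i ρ 0 false _ | true = refl
  ind-rank i ρ 1 true  _ | true = refl
  ind-rank i ρ 1 false _ | true = refl
  ind-rank i ρ 2 true  _ | true = refl
  ind-rank i ρ 2 false _ | true = refl
  ind-rank i ρ 3 true  _ | true = refl
  ind-rank i ρ 3 false _ | true = refl
  ind-rank i ρ 4 true  _ | true = refl
  ind-rank i ρ 4 false _ | true = refl
  ind-rank i ρ (suc (suc (suc (suc (suc e))))) φ (s≤s (s≤s (s≤s (s≤s ())))) | true
  ind-rank i ρ e true  _ | false = refl
  ind-rank i ρ e false _ | false = refl

  Γ≡∑occurrences : ∀ i k → Γ i k ≡ ∑ (states i) (occurrences 4 k)
  Γ≡∑occurrences i k = begin
    Γ i k
      ≡⟨ length-filterᵇ _ (allVecs (allBits (suc k)) 4) ⟩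
    ∑ (allVecs (allBits (suc k)) 4) (λ αs → ind (rank (quadMatrix αs) ≡ᵇ i))
      ≡⟨ ∑-transpose (suc k) 4 _ ⟩
    ∑ seqs (λ s → ind (rank (quadMatrix (transpose s)) ≡ᵇ i))
      ≡⟨ ∑-cong seqs (λ s → trans (cong (λ r → ind (r ≡ᵇ i)) (rank-quadMatrix s)) (split s)) ⟩
    ∑ seqs (λ s → ∑ (states i) (λ σ → ind (state s ==ˢ σ)))
      ≡⟨ ∑-swap seqs (states i) (λ s σ → ind (state s ==ˢ σ)) ⟩
    ∑ (states i) (occurrences 4 k) ∎
    where
      open ≡-Reasoning
      seqs = allVecs (allBits 4) (suc k)
      split : ∀ s → ind (proj₁ (state s) ≡ᵇ i) ≡ ∑ (states i) (λ σ → ind (state s ==ˢ σ))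
      split (b ∷ s) =
        ind-rank i (dim (toList (pairs (b ∷ s)))) (dim (toList s)) (span (toList s) b) (dim≤ (toList s))

open Counting
open import Data.Integer using (ℤ; +_; _+_; _-_; _*_; _^_)
open import Data.Integer using (-_)
import Data.Integer.Properties as ℤ
open import Data.Integer.Solver using (module +-*-Solver)
import Data.Nat as ℕ
import Data.Nat.Properties as ℕ

-- Closed forms

-- Degree 4 suffices: the growth rates are the loop weights 2^(r - d), and r - d ≤ d ≤ 4 for the
-- states with loops that occur.
Poly : Set
Poly = Vec ℤ 5

eval : ∀ {m} → Vec ℤ m → ℤ → ℤ
eval []      t = + 0
eval (c ∷ p) t = c + t * eval p t

addᵖ : ∀ {m} → Vec ℤ m → Vec ℤ m → Vec ℤ m
addᵖ = zipWith _+_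

scaleᵖ : ∀ {m} → ℤ → Vec ℤ m → Vec ℤ m
scaleᵖ a = Vec.map (a *_)

-- The substitution of 2t for t, which is the effect of passing from k to k + 1 on t = 2ᵏ.
dilateᵖ : ∀ {m} → Vec ℤ m → Vec ℤ m
dilateᵖ []      = []
dilateᵖ (c ∷ p) = c ∷ scaleᵖ (+ 2) (dilateᵖ p)

eval-zero : ∀ m t → eval (replicate m (+ 0)) t ≡ + 0
eval-zero zero    t = refl
eval-zero (suc m) t = trans (ℤ.+-identityˡ _) (trans (cong (t *_) (eval-zero m t)) (ℤ.*-zeroʳ t))

eval-add : ∀ {m} (p q : Vec ℤ m) t → eval (addᵖ p q) t ≡ eval p t + eval q t
eval-add []      []      t = refl
eval-add (c ∷ p) (e ∷ q) t = trans (cong (λ z → c + e + t * z) (eval-add p q t))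
  (solve 5 (λ c e t x y → (c :+ e) :+ t :* (x :+ y) := (c :+ t :* x) :+ (e :+ t :* y)) refl c e t (eval p t) (eval q t))
  where open +-*-Solver

eval-scale : ∀ {m} a (p : Vec ℤ m) t → eval (scaleᵖ a p) t ≡ a * eval p t
eval-scale a []      t = sym (ℤ.*-zeroʳ a)
eval-scale a (c ∷ p) t = trans (cong (λ z → a * c + t * z) (eval-scale a p t))
  (solve 4 (λ a c t x → a :* c :+ t :* (a :* x) := a :* (c :+ t :* x)) refl a c t (eval p t))
  where open +-*-Solver

eval-dilate : ∀ {m} (p : Vec ℤ m) t → eval (dilateᵖ p) t ≡ eval p (+ 2 * t)
eval-dilate []      t = refl
eval-dilate (c ∷ p) t = begin
  c + t * eval (scaleᵖ (+ 2) (dilateᵖ p)) t ≡⟨ cong (λ z → c + t * z) (eval-scale (+ 2) (dilateᵖ p) t) ⟩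
  c + t * (+ 2 * eval (dilateᵖ p) t)        ≡⟨ cong (λ z → c + t * (+ 2 * z)) (eval-dilate p t) ⟩
  c + t * (+ 2 * eval p (+ 2 * t))
    ≡⟨ solve 3 (λ c t x → c :+ t :* (con (+ 2) :* x) := c :+ con (+ 2) :* t :* x) refl c t (eval p (+ 2 * t)) ⟩
  c + + 2 * t * eval p (+ 2 * t)            ∎
  where
    open ≡-Reasoning
    open +-*-Solver

-- Coefficients of 1, t, …, t⁴ for t = 2ᵏ, interpolated from the recurrence at k = 4, …, 8.
closedForm : State → Poly
closedForm (0 , 0 , true ) = + 1 ∷ + 0 ∷ + 0 ∷ + 0 ∷ + 0 ∷ []
closedForm (1 , 0 , false) = + 15 ∷ + 0 ∷ + 0 ∷ + 0 ∷ + 0 ∷ []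
closedForm (1 , 1 , true ) = + 30 ∷ + 0 ∷ + 0 ∷ + 0 ∷ + 0 ∷ []
closedForm (2 , 1 , true ) = - + 60 ∷ + 30 ∷ + 0 ∷ + 0 ∷ + 0 ∷ []
closedForm (2 , 1 , false) = + 630 ∷ + 0 ∷ + 0 ∷ + 0 ∷ + 0 ∷ []
closedForm (2 , 2 , true ) = + 840 ∷ + 0 ∷ + 0 ∷ + 0 ∷ + 0 ∷ []
closedForm (3 , 1 , false) = - + 840 ∷ + 210 ∷ + 0 ∷ + 0 ∷ + 0 ∷ []
closedForm (3 , 2 , true ) = - + 5040 ∷ + 1260 ∷ + 0 ∷ + 0 ∷ + 0 ∷ []
closedForm (3 , 2 , false) = + 17640 ∷ + 0 ∷ + 0 ∷ + 0 ∷ + 0 ∷ []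
closedForm (3 , 3 , true ) = + 20160 ∷ + 0 ∷ + 0 ∷ + 0 ∷ + 0 ∷ []
closedForm (4 , 2 , true ) = + 4480 ∷ - + 1680 ∷ + 140 ∷ + 0 ∷ + 0 ∷ []
closedForm (4 , 2 , false) = - + 70560 ∷ + 8820 ∷ + 0 ∷ + 0 ∷ + 0 ∷ []
closedForm (4 , 3 , true ) = - + 282240 ∷ + 35280 ∷ + 0 ∷ + 0 ∷ + 0 ∷ []
closedForm (4 , 3 , false) = + 302400 ∷ + 0 ∷ + 0 ∷ + 0 ∷ + 0 ∷ []
closedForm (4 , 4 , true ) = + 322560 ∷ + 0 ∷ + 0 ∷ + 0 ∷ + 0 ∷ []
closedForm (5 , 2 , false) = + 53760 ∷ - + 10080 ∷ + 420 ∷ + 0 ∷ + 0 ∷ []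
closedForm (5 , 3 , true ) = + 752640 ∷ - + 141120 ∷ + 5880 ∷ + 0 ∷ + 0 ∷ []
closedForm (5 , 3 , false) = - + 2822400 ∷ + 176400 ∷ + 0 ∷ + 0 ∷ + 0 ∷ []
closedForm (5 , 4 , true ) = - + 9676800 ∷ + 604800 ∷ + 0 ∷ + 0 ∷ + 0 ∷ []
closedForm (6 , 3 , true ) = - + 491520 ∷ + 107520 ∷ - + 6720 ∷ + 120 ∷ + 0 ∷ []
closedForm (6 , 3 , false) = + 6451200 ∷ - + 604800 ∷ + 12600 ∷ + 0 ∷ + 0 ∷ []
closedForm (6 , 4 , true ) = + 60211200 ∷ - + 5644800 ∷ + 117600 ∷ + 0 ∷ + 0 ∷ []
closedForm (7 , 3 , false) = - + 3932160 ∷ + 430080 ∷ - + 13440 ∷ + 120 ∷ + 0 ∷ []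
closedForm (7 , 4 , true ) = - + 117964800 ∷ + 12902400 ∷ - + 403200 ∷ + 3600 ∷ + 0 ∷ []
closedForm (8 , 4 , true ) = + 67108864 ∷ - + 7864320 ∷ + 286720 ∷ - + 3840 ∷ + 16 ∷ []
-- The remaining states do not occur for k ≥ 4. Always d ≤ r, with r ≤ 2d for flag `true` and r ≤ 2d
-- + 1 for `false`; the flag is `true` when d = 4; and `(d , d , false)` needs all k + 1 terms to be
-- independent, so k = d ≤ 3.
closedForm _ = replicate 5 (+ 0)

combine : List (ℕ × State) → Poly
combine []             = replicate 5 (+ 0)
combine ((w , σ) ∷ ps) = addᵖ (scaleᵖ (+ w) (closedForm σ)) (combine ps)

eval-combine : ∀ (N : State → ℕ) t ps → All (λ p → + N (proj₂ p) ≡ eval (closedForm (proj₂ p)) t) ps →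
               + weightedSum N ps ≡ eval (combine ps) t
eval-combine N t []             []         = sym (eval-zero 5 t)
eval-combine N t ((w , σ) ∷ ps) (eq ∷ eqs) = begin
  + (w ℕ.* N σ ℕ.+ weightedSum N ps)    ≡⟨ ℤ.pos-+ (w ℕ.* N σ) _ ⟩
  + (w ℕ.* N σ) + + weightedSum N ps    ≡⟨ cong (_+ + weightedSum N ps) (ℤ.pos-* w (N σ)) ⟩
  + w * + N σ + + weightedSum N ps      ≡⟨ cong₂ (λ x y → + w * x + y) eq (eval-combine N t ps eqs) ⟩
  + w * eval (closedForm σ) t + eval (combine ps) t
    ≡⟨ cong (_+ eval (combine ps) t) (sym (eval-scale (+ w) (closedForm σ) t)) ⟩
  eval (scaleᵖ (+ w) (closedForm σ)) t + eval (combine ps) t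
    ≡⟨ sym (eval-add (scaleᵖ (+ w) (closedForm σ)) (combine ps) t) ⟩
  eval (combine ((w , σ) ∷ ps)) t       ∎
  where open ≡-Reasoning

-- Verification of the closed forms

InRange : State → Set
InRange (r , d , _) = r < 9 × d < 5

-- Prepending a term never lowers r or d. The recurrence therefore stays within 90 states, over
-- which its identities can be decided by evaluation.
predecessors-inRange : ∀ σ → InRange σ → All (InRange ∘ proj₂) (predecessors 4 σ)
predecessors-inRange (zero  , d     , true)  p       = p ∷ []
predecessors-inRange (suc r , zero  , true)  (p , q) = (p , q) ∷ (ℕ.<⇒≤ p , q) ∷ []
predecessors-inRange (suc r , suc d , true)  (p , q) =
  (p , q) ∷ (ℕ.<⇒≤ p , q) ∷ (ℕ.<⇒≤ p , ℕ.<⇒≤ q) ∷ []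
predecessors-inRange (zero  , d     , false) p       = []
predecessors-inRange (suc r , zero  , false) (p , q) = (ℕ.<⇒≤ p , q) ∷ []
predecessors-inRange (suc r , suc d , false) (p , q) = (ℕ.<⇒≤ p , q) ∷ (ℕ.<⇒≤ p , ℕ.<⇒≤ q) ∷ []

decideInRange : ∀ {P : State → Set} → (∀ σ → Dec (P σ)) →
                Dec (∀ {r} → r < 9 → ∀ {d} → d < 5 → P (r , d , true) × P (r , d , false))
decideInRange P? = ℕ.allUpTo? (λ r → ℕ.allUpTo? (λ d → P? (r , d , true) ×-dec P? (r , d , false)) 5) 9

atState : ∀ {P : State → Set} → (∀ {r} → r < 9 → ∀ {d} → d < 5 → P (r , d , true) × P (r , d , false)) →
          ∀ σ → InRange σ → P σ
atState h (r , d , true)  (p , q) = proj₁ (h p q)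
atState h (r , d , false) (p , q) = proj₂ (h p q)

-- Compared coefficient by coefficient, the identities no longer mention k, so one finite check
-- provides the induction step for every k.
closedForm-step : ∀ σ → InRange σ → combine (predecessors 4 σ) ≡ dilateᵖ (closedForm σ)
closedForm-step = atState {λ σ → combine (predecessors 4 σ) ≡ dilateᵖ (closedForm σ)} (from-yes (decideInRange
  λ σ → ≡-dec ℤ._≟_ (combine (predecessors 4 σ)) (dilateᵖ (closedForm σ))))

-- Makes the base case computable: enumeration at k = 4 would range over 16⁵ sequences. Only k = 0
-- is enumerated, where the single term is zero (1 way) or not (15 ways).
iterate : ℕ → State → ℕ
iterate zero    (0 , 0 , true)  = 1
iterate zero    (0 , 0 , false) = 15
iterate zero    _               = 0
iterate (suc k) σ = weightedSum (iterate k) (predecessors 4 σ)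

occurrences≡iterate : ∀ k σ → occurrences 4 k σ ≡ iterate k σ
occurrences≡iterate zero    (zero  , zero  , true)  = refl
occurrences≡iterate zero    (zero  , zero  , false) = refl
occurrences≡iterate zero    (zero  , suc d , true)  = refl
occurrences≡iterate zero    (zero  , suc d , false) = refl
occurrences≡iterate zero    (suc r , d     , true)  = refl
occurrences≡iterate zero    (suc r , d     , false) = refl
occurrences≡iterate (suc k) σ = trans (occurrences-suc 4 k σ)
  (∑-cong (predecessors 4 σ) λ p → cong (proj₁ p ℕ.*_) (occurrences≡iterate k (proj₂ p)))

closedForm-base : ∀ σ → InRange σ → + iterate 4 σ ≡ eval (closedForm σ) (+ 16)
closedForm-base = atState {λ σ → + iterate 4 σ ≡ eval (closedForm σ) (+ 16)} (from-yes (decideInRange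
  λ σ → + iterate 4 σ ℤ.≟ eval (closedForm σ) (+ 16)))

occurrences≡closedForm : ∀ m σ → InRange σ → + occurrences 4 (m ℕ.+ 4) σ ≡ eval (closedForm σ) ((+ 2) ^ (m ℕ.+ 4))
occurrences≡closedForm zero    σ p = trans (cong +_ (occurrences≡iterate 4 σ)) (closedForm-base σ p)
occurrences≡closedForm (suc m) σ p = begin
  + occurrences 4 (suc k) σ                        ≡⟨ cong +_ (occurrences-suc 4 k σ) ⟩
  + weightedSum (occurrences 4 k) (predecessors 4 σ)
    ≡⟨ eval-combine (occurrences 4 k) t (predecessors 4 σ)
         (All.map (λ {q} → occurrences≡closedForm m (proj₂ q)) (predecessors-inRange σ p)) ⟩
  eval (combine (predecessors 4 σ)) t              ≡⟨ cong (λ q → eval q t) (closedForm-step σ p) ⟩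
  eval (dilateᵖ (closedForm σ)) t                  ≡⟨ eval-dilate (closedForm σ) t ⟩
  eval (closedForm σ) (+ 2 * t)                    ∎
  where
    open ≡-Reasoning
    k = m ℕ.+ 4
    t = (+ 2) ^ k

rankPoly : ℕ → Poly
rankPoly i = combine (map (1 ,_) (states i))

states-inRange : ∀ i → i < 9 → All (InRange ∘ proj₂) (map (1 ,_) (states i))
states-inRange i p = at 0 ∷ at 0 ∷ at 1 ∷ at 1 ∷ at 2 ∷ at 2 ∷ at 3 ∷ at 3 ∷ at 4 ∷ at 4 ∷ []
  where
    at : ∀ d {d<5 : True (d ℕ.<? 5)} → i < 9 × d < 5
    at d {d<5} = p , toWitness d<5

-- The equation for `p` lets each use state the coefficients as literals in the shape that an
-- evaluation lemma expects; `refl` then computes `rankPoly i`.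
Γ≡rankPoly : ∀ i {p} → rankPoly i ≡ p → i < 9 → ∀ k → k ≥ 4 → + Γ i k ≡ eval p ((+ 2) ^ k)
Γ≡rankPoly i refl i<9 k k≥4 = subst (λ k → + Γ i k ≡ eval (rankPoly i) ((+ 2) ^ k)) (ℕ.m∸n+n≡m k≥4) (begin
  + Γ i k′                                 ≡⟨ cong +_ (Γ≡∑occurrences i k′) ⟩
  + ∑ (states i) (occurrences 4 k′)
    ≡⟨ cong +_ (∑-cong (states i) λ σ → sym (ℕ.*-identityˡ (occurrences 4 k′ σ))) ⟩
  + ∑ (states i) (λ σ → 1 ℕ.* occurrences 4 k′ σ)
    ≡⟨ cong +_ (sym (∑-map (1 ,_) (states i) (λ p → proj₁ p ℕ.* occurrences 4 k′ (proj₂ p)))) ⟩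
  + weightedSum (occurrences 4 k′) (map (1 ,_) (states i))
    ≡⟨ eval-combine (occurrences 4 k′) ((+ 2) ^ k′) (map (1 ,_) (states i))
         (All.map (λ {q} → occurrences≡closedForm (k ∸ 4) (proj₂ q)) (states-inRange i i<9)) ⟩
  eval (rankPoly i) ((+ 2) ^ k′)           ∎)
  where
    open ≡-Reasoning
    k′ = k ∸ 4 ℕ.+ 4

-- Horner evaluation rewritten in descending powers with explicit signs

eval-constant : ∀ a t → eval (a ∷ + 0 ∷ + 0 ∷ + 0 ∷ + 0 ∷ []) t ≡ a
eval-constant a t = solve 2 (λ a t →
    a :+ t :* (con (+ 0) :+ t :* (con (+ 0) :+ t :* (con (+ 0) :+ t :* (con (+ 0) :+ t :* con (+ 0)))))
      := a)
  refl a t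
  where open +-*-Solver

eval-linear : ∀ a b t → eval (a ∷ b ∷ + 0 ∷ + 0 ∷ + 0 ∷ []) t ≡ b * t + a
eval-linear a b t = solve 3 (λ a b t →
    a :+ t :* (b :+ t :* (con (+ 0) :+ t :* (con (+ 0) :+ t :* (con (+ 0) :+ t :* con (+ 0)))))
      := b :* t :+ a)
  refl a b t
  where open +-*-Solver

eval-quadratic⁺ : ∀ a b c t → eval (a ∷ b ∷ c ∷ + 0 ∷ + 0 ∷ []) t ≡ c * t ^ 2 + b * t + a
eval-quadratic⁺ a b c t = solve 4 (λ a b c t →
    a :+ t :* (b :+ t :* (c :+ t :* (con (+ 0) :+ t :* (con (+ 0) :+ t :* con (+ 0)))))
      -- `t :* (t :* con (+ 1))` is what `t ^ 2` unfolds to, so that `refl` suffices; likewise for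
      -- the higher powers below.
      := c :* (t :* (t :* con (+ 1))) :+ b :* t :+ a)
  refl a b c t
  where open +-*-Solver

eval-quadratic⁻ : ∀ a b c t → eval (- a ∷ b ∷ c ∷ + 0 ∷ + 0 ∷ []) t ≡ c * t ^ 2 + b * t - a
eval-quadratic⁻ a b c t = solve 4 (λ a b c t →
    (:- a) :+ t :* (b :+ t :* (c :+ t :* (con (+ 0) :+ t :* (con (+ 0) :+ t :* con (+ 0)))))
      := c :* (t :* (t :* con (+ 1))) :+ b :* t :- a)
  refl a b c t
  where open +-*-Solver

eval-cubic⁺ : ∀ a b c d t → eval (a ∷ - b ∷ c ∷ d ∷ + 0 ∷ []) t ≡ d * t ^ 3 + c * t ^ 2 - b * t + a
eval-cubic⁺ a b c d t = solve 5 (λ a b c d t →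
    a :+ t :* ((:- b) :+ t :* (c :+ t :* (d :+ t :* (con (+ 0) :+ t :* con (+ 0)))))
      := d :* (t :* (t :* (t :* con (+ 1)))) :+ c :* (t :* (t :* con (+ 1))) :- b :* t :+ a)
  refl a b c d t
  where open +-*-Solver

eval-cubic⁻ : ∀ a b c d t → eval (- a ∷ b ∷ - c ∷ d ∷ + 0 ∷ []) t ≡ d * t ^ 3 - c * t ^ 2 + b * t - a
eval-cubic⁻ a b c d t = solve 5 (λ a b c d t →
    (:- a) :+ t :* (b :+ t :* ((:- c) :+ t :* (d :+ t :* (con (+ 0) :+ t :* con (+ 0)))))
      := d :* (t :* (t :* (t :* con (+ 1)))) :- c :* (t :* (t :* con (+ 1))) :+ b :* t :- a)
  refl a b c d t
  where open +-*-Solver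

eval-quartic : ∀ a b c d e t → eval (a ∷ - b ∷ c ∷ - d ∷ e ∷ []) t ≡ e * t ^ 4 - d * t ^ 3 + c * t ^ 2 - b * t + a
eval-quartic a b c d e t = solve 6 (λ a b c d e t →
    a :+ t :* ((:- b) :+ t :* (c :+ t :* ((:- d) :+ t :* (e :+ t :* con (+ 0)))))
      := e :* (t :* (t :* (t :* (t :* con (+ 1))))) :- d :* (t :* (t :* (t :* con (+ 1)))) :+ c :* (t :* (t :* con (+ 1))) :- b :* t :+ a)
  refl a b c d e t
  where open +-*-Solver

theorem5p2 : (k : ℕ) → k ≥ 4 →
    let t = (+ 2) ^ k in
    (+ Γ 0 k ≡ + 1) ×
    (+ Γ 1 k ≡ + 45) ×
    (+ Γ 2 k ≡ + 30 * t + + 1410) ×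
    (+ Γ 3 k ≡ + 1470 * t + + 31920) ×
    (+ Γ 4 k ≡ + 140 * t ^ 2 + + 42420 * t + + 276640) ×
    (+ Γ 5 k ≡ + 6300 * t ^ 2 + + 630000 * t - + 11692800) ×
    (+ Γ 6 k ≡ + 120 * t ^ 3 + + 123480 * t ^ 2 - + 6142080 * t + + 66170880) ×
    (+ Γ 7 k ≡ + 3720 * t ^ 3 - + 416640 * t ^ 2 + + 13332480 * t - + 121896960) ×
    (+ Γ 8 k ≡ + 16 * t ^ 4 - + 3840 * t ^ 3 + + 286720 * t ^ 2 - + 7864320 * t + (+ 2) ^ 26)
theorem5p2 k k≥4 =
    trans (Γ≡rankPoly 0 refl (from-yes (0 ℕ.<? 9)) k k≥4) (eval-constant (+ 1) t)
  , trans (Γ≡rankPoly 1 refl (from-yes (1 ℕ.<? 9)) k k≥4) (eval-constant (+ 45) t)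
  , trans (Γ≡rankPoly 2 refl (from-yes (2 ℕ.<? 9)) k k≥4) (eval-linear (+ 1410) (+ 30) t)
  , trans (Γ≡rankPoly 3 refl (from-yes (3 ℕ.<? 9)) k k≥4) (eval-linear (+ 31920) (+ 1470) t)
  , trans (Γ≡rankPoly 4 refl (from-yes (4 ℕ.<? 9)) k k≥4) (eval-quadratic⁺ (+ 276640) (+ 42420) (+ 140) t)
  , trans (Γ≡rankPoly 5 refl (from-yes (5 ℕ.<? 9)) k k≥4) (eval-quadratic⁻ (+ 11692800) (+ 630000) (+ 6300) t)
  , trans (Γ≡rankPoly 6 refl (from-yes (6 ℕ.<? 9)) k k≥4) (eval-cubic⁺ (+ 66170880) (+ 6142080) (+ 123480) (+ 120) t)
  , trans (Γ≡rankPoly 7 refl (from-yes (7 ℕ.<? 9)) k k≥4) (eval-cubic⁻ (+ 121896960) (+ 13332480) (+ 416640) (+ 3720) t)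
  -- The computed constant coefficient is 67108864, the value of `(+ 2) ^ 26`.
  , trans (Γ≡rankPoly 8 refl (from-yes (8 ℕ.<? 9)) k k≥4) (eval-quartic ((+ 2) ^ 26) (+ 7864320) (+ 286720) (+ 3840) (+ 16) t)
  where t = (+ 2) ^ k
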